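{- Let $c_0$ be a proper $4$-colouring of the plane, let $\mu$ be a left-invariant finitely additive probability measure on $S_4\times E(2)$, and let $p_d$ be the associated monochromaticity probabilities (see context). Then for real $d$: (1) if $\frac12\le d\le\sqrt{\frac12(2-\sqrt2)(3-\sqrt3)}$, then $p_d\ge\frac1{150}$; (2) if $\sqrt{\frac12(2-\sqrt2)(3-\sqrt3)}<d\le\sqrt{\frac{19}{15}-\frac2{\sqrt5}}$, then $p_d\ge\frac{14}{2325}$; (3) if $\sqrt{\frac{19}{15}-\frac2{\sqrt5}}<d\le\frac12\sqrt{5-2\sqrt3}$, then $p_d\ge\frac1{300}$; (4) if $\frac12\sqrt{5+2\sqrt3}\le d<\sqrt{\frac{19}{15}+\frac2{\sqrt5}}$, then $p_d\ge\frac1{300}$; (5) if $\sqrt{\frac{19}{15}+\frac2{\sqrt5}}\le d<\sqrt{\frac12(2+\sqrt2)(3-\sqrt3)}$, then $p_d\ge\frac{14}{2325}$; (6) if $\sqrt{\frac12(2+\sqrt2)(3-\sqrt3)}\le d$, then $p_d\ge\frac1{150}$.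
   Context: Identify the plane with $\mathbb C$. A proper $4$-colouring of the plane is a map $c_0:\mathbb C\to\{1,2,3,4\}$ such that no two points at distance $1$ have the same colour. Let $S_4$ be the group of permutations of the colours and $E(2)$ the group of Euclidean isometries of the plane. The group $S_4\times E(2)$ is amenable, so there is a finitely additive probability measure $\mu$ defined on all subsets of $S_4\times E(2)$ which is left-invariant, i.e. $\mu(gE)=\mu(E)$ for all $g\in S_4\times E(2)$ and $E\subseteq S_4\times E(2)$. For $(\sigma,T)\in S_4\times E(2)$ consider the (random) colouring $c=\sigma\circ c_0\circ T^{ -1}$. For $d\ge 0$, $p_d$ denotes the probability that two points $A,B$ at distance $d$ get the same colour: $p_d=\mu(\{(\sigma,T): c(A)=c(B)\})$; by left-invariance this does not depend on the choice of $A,B$ with $|AB|=d$. The existence of $c_0$ is a standing assumption, and $c_0,\mu$ are arbitrary but fixed. -}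

module Defs where

open import Algebra.Bundles using (CommutativeRing; Group)
import Algebra.Construct.DirectProduct as DirectProduct
import Algebra.Properties.Ring as RingProperties
import Algebra.Properties.Semiring.Mult as Mult
import Algebra.Solver.Ring.NaturalCoefficients.Default as NatSolver
open import Axiom.ExcludedMiddle using (ExcludedMiddle)
open import Data.Empty using (⊥-elim)
open import Data.Fin.Base using (Fin)
open import Data.Nat.Base using (ℕ)
open import Data.Product.Base using (∃; _×_; _,_; proj₁; proj₂)
open import Data.Product.Relation.Binary.Pointwise.NonDependent using (×-setoid)
open import Data.Sum.Base using (_⊎_; inj₁; inj₂; [_,_]′)
open import Function.Bundles using (Func; Inverse)
import Function.Construct.Composition as Composition
import Function.Construct.Identity as Identity
import Function.Construct.Symmetry as Symmetry
open import Level using (0ℓ)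
open import Relation.Binary.Bundles using (Setoid; Poset)
open import Relation.Binary.Core using (Rel)
open import Relation.Binary.Definitions using (_Respects_)
import Relation.Binary.Construct.NonStrictToStrict as NonStrictToStrict
open import Relation.Binary.PropositionalEquality.Core using (_≡_; _≢_; cong; trans; sym)
import Relation.Binary.PropositionalEquality.Properties as ≡
import Relation.Binary.Reasoning.PartialOrder as PosetReasoning
open import Relation.Binary.Structures using (IsTotalOrder)
open import Relation.Nullary.Decidable.Core using (yes; no)
open import Relation.Nullary.Negation.Core using (¬_)
open import Relation.Unary using (Pred; Empty; U; _∩_; _∪_; _≐_)

-- The real numbers, axiomatised (up to isomorphism) as a Dedekind-complete
-- ordered field.  The value of 0# ⁻¹ is unspecified.
record CompleteOrderedField : Set₁ where
  field
    commutativeRing : CommutativeRing 0ℓ 0ℓ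

  open CommutativeRing commutativeRing public

  infix  4 _≤_ _<_
  infix  8 _⁻¹
  infixl 7 _/_
  infixr 9 #_

  field
    _≤_          : Rel Carrier 0ℓ
    isTotalOrder : IsTotalOrder _≈_ _≤_
    +-monoˡ-≤    : ∀ {x y} z → x ≤ y → x + z ≤ y + z
    *-nonneg     : ∀ {x y} → 0# ≤ x → 0# ≤ y → 0# ≤ x * y
    0≉1          : ¬ 0# ≈ 1#
    _⁻¹          : Carrier → Carrier
    ⁻¹-inverseʳ  : ∀ {x} → ¬ x ≈ 0# → x * x ⁻¹ ≈ 1#

  UpperBound : Pred Carrier 0ℓ → Pred Carrier 0ℓ
  UpperBound S b = ∀ x → S x → x ≤ b

  field
    supremum : (S : Pred Carrier 0ℓ) → ∃ S → ∃ (UpperBound S) →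
               ∃ λ s → UpperBound S s × (∀ b → UpperBound S b → s ≤ b)

  open IsTotalOrder isTotalOrder public
    using (total; antisym; isPartialOrder)
    renaming (refl to ≤-refl; trans to ≤-trans; reflexive to ≤-reflexive)

  _<_ : Rel Carrier 0ℓ
  _<_ = NonStrictToStrict._<_ _≈_ _≤_

  _/_ : Carrier → Carrier → Carrier
  x / y = x * y ⁻¹

  #_ : ℕ → Carrier
  # n = n ×ᵐ 1#
    where open Mult semiring using () renaming (_×_ to _×ᵐ_)

module Reals (ℝ : CompleteOrderedField) where
  open CompleteOrderedField ℝ
    renaming (trans to ≈-trans; sym to ≈-sym; refl to ≈-refl)
  open RingProperties ring using (-‿involutive; -‿distribʳ-*; [y-z]x≈yx-zx)

  private
    poset : Poset 0ℓ 0ℓ 0ℓ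
    poset = record { isPartialOrder = isPartialOrder }

  open PosetReasoning poset

  x≤y⇒0≤y-x : ∀ {x y} → x ≤ y → 0# ≤ y - x
  x≤y⇒0≤y-x {x} {y} x≤y = begin
    0#     ≈⟨ -‿inverseʳ x ⟨
    x - x  ≤⟨ +-monoˡ-≤ (- x) x≤y ⟩
    y - x  ∎

  [y-x]+x≈y : ∀ x y → y - x + x ≈ y
  [y-x]+x≈y x y = begin-equality
    y - x + x      ≈⟨ +-assoc y (- x) x ⟩
    y + (- x + x)  ≈⟨ +-congˡ (-‿inverseˡ x) ⟩
    y + 0#         ≈⟨ +-identityʳ y ⟩
    y              ∎

  [x+z]-z≈x : ∀ x z → x + z - z ≈ x
  [x+z]-z≈x x z = begin-equality
    x + z - z    ≈⟨ +-assoc x z (- z) ⟩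
    x + (z - z)  ≈⟨ +-congˡ (-‿inverseʳ z) ⟩
    x + 0#       ≈⟨ +-identityʳ x ⟩
    x            ∎

  0≤y-x⇒x≤y : ∀ {x y} → 0# ≤ y - x → x ≤ y
  0≤y-x⇒x≤y {x} {y} 0≤d = begin
    x          ≈⟨ +-identityˡ x ⟨
    0# + x     ≤⟨ +-monoˡ-≤ x 0≤d ⟩
    y - x + x  ≈⟨ [y-x]+x≈y x y ⟩
    y          ∎

  +-cancelʳ-≤ : ∀ {x y} z → x + z ≤ y + z → x ≤ y
  +-cancelʳ-≤ {x} {y} z p = begin
    x          ≈⟨ [x+z]-z≈x x z ⟨
    x + z - z  ≤⟨ +-monoˡ-≤ (- z) p ⟩
    y + z - z  ≈⟨ [x+z]-z≈x y z ⟩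
    y          ∎

  x≤y+x : ∀ {x y} → 0# ≤ y → x ≤ y + x
  x≤y+x {x} {y} 0≤y = begin
    x       ≈⟨ +-identityˡ x ⟨
    0# + x  ≤⟨ +-monoˡ-≤ x 0≤y ⟩
    y + x   ∎

  *-monoˡ-≤ : ∀ {x y z} → 0# ≤ z → x ≤ y → x * z ≤ y * z
  *-monoˡ-≤ {x} {y} {z} 0≤z x≤y = 0≤y-x⇒x≤y (begin
    0#             ≤⟨ *-nonneg (x≤y⇒0≤y-x x≤y) 0≤z ⟩
    (y - x) * z    ≈⟨ [y-z]x≈yx-zx z y x ⟩
    y * z - x * z  ∎)

  0≤-x : ∀ {x} → x ≤ 0# → 0# ≤ - x
  0≤-x {x} x≤0 = begin
    0#      ≤⟨ x≤y⇒0≤y-x x≤0 ⟩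
    0# - x  ≈⟨ +-identityˡ (- x) ⟩
    - x     ∎

  0≤1 : 0# ≤ 1#
  0≤1 with total 0# 1#
  ... | inj₁ 0≤1 = 0≤1
  ... | inj₂ 1≤0 = begin
    0#             ≤⟨ *-nonneg (0≤-x 1≤0) (0≤-x 1≤0) ⟩
    - 1# * - 1#    ≈⟨ -‿distribʳ-* (- 1#) 1# ⟨
    - (- 1# * 1#)  ≈⟨ -‿cong (*-identityʳ (- 1#)) ⟩
    - - 1#         ≈⟨ -‿involutive 1# ⟩
    1#             ∎

  x≤x*x : ∀ {x} → 1# ≤ x → x ≤ x * x
  x≤x*x {x} 1≤x = begin
    x       ≈⟨ *-identityˡ x ⟨
    1# * x  ≤⟨ *-monoˡ-≤ (≤-trans 0≤1 1≤x) 1≤x ⟩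
    x * x   ∎

  private
    Below√ : Carrier → Pred Carrier 0ℓ
    Below√ x y = y ≤ 0# ⊎ y * y ≤ x

    Below√-bounded : ∀ x → ∃ (UpperBound (Below√ x))
    Below√-bounded x = [ (λ x≤1 → 1# , bound ≤-refl x≤1) , (λ 1≤x → x , bound 1≤x ≤-refl) ]′ (total x 1#)
      where
      bound : ∀ {b} → 1# ≤ b → x ≤ b → UpperBound (Below√ x) b
      bound 1≤b x≤b y (inj₁ y≤0)  = ≤-trans y≤0 (≤-trans 0≤1 1≤b)
      bound 1≤b x≤b y (inj₂ y²≤x) with total y 1#
      ... | inj₁ y≤1 = ≤-trans y≤1 1≤b
      ... | inj₂ 1≤y = ≤-trans (x≤x*x 1≤y) (≤-trans y²≤x x≤b)

    √-supremum : ∀ x → ∃ λ s → UpperBound (Below√ x) s ×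
                               (∀ b → UpperBound (Below√ x) b → s ≤ b)
    √-supremum x = supremum (Below√ x) (0# , inj₁ ≤-refl) (Below√-bounded x)

  infixr 9 √_

  -- √ x = sup { y | y ≤ 0 or y² ≤ x }: the nonnegative square root of x
  -- when 0 ≤ x (see √-nonneg and √-square), and 0 when x < 0.
  √_ : Carrier → Carrier
  √ x = proj₁ (√-supremum x)

  √-nonneg : ∀ x → 0# ≤ √ x
  √-nonneg x = proj₁ (proj₂ (√-supremum x)) 0# (inj₁ ≤-refl)

  √-mono-≤ : ∀ {x y} → x ≤ y → √ x ≤ √ y
  √-mono-≤ {x} {y} x≤y = proj₂ (proj₂ (√-supremum x)) (√ y) λ where
    z (inj₁ z≤0)  → proj₁ (proj₂ (√-supremum y)) z (inj₁ z≤0)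
    z (inj₂ z²≤x) → proj₁ (proj₂ (√-supremum y)) z (inj₂ (≤-trans z²≤x x≤y))

  √-cong : ∀ {x y} → x ≈ y → √ x ≈ √ y
  √-cong x≈y = antisym (√-mono-≤ (≤-reflexive x≈y)) (√-mono-≤ (≤-reflexive (≈-sym x≈y)))

  module _ (em : ExcludedMiddle 0ℓ) where

    ⁻¹-nonneg : ∀ {x} → 0# ≤ x → ¬ x ≈ 0# → 0# ≤ x ⁻¹
    ⁻¹-nonneg {x} 0≤x x≉0 with total 0# (x ⁻¹)
    ... | inj₁ p = p
    ... | inj₂ p = ⊥-elim (0≉1 (antisym 0≤1 (0≤y-x⇒x≤y (begin
      0#              ≤⟨ *-nonneg 0≤x (0≤-x p) ⟩
      x * (- (x ⁻¹))  ≈⟨ -‿distribʳ-* x (x ⁻¹) ⟨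
      - (x * x ⁻¹)    ≈⟨ -‿cong (⁻¹-inverseʳ x≉0) ⟩
      - 1#            ≈⟨ +-identityˡ (- 1#) ⟨
      0# - 1#         ∎))))

    *-cancelʳ-≤ : ∀ {x y z} → 0# ≤ z → ¬ z ≈ 0# → x * z ≤ y * z → x ≤ y
    *-cancelʳ-≤ {x} {y} {z} 0≤z z≉0 p = begin
      x               ≈⟨ undo x ⟨
      x * z * z ⁻¹    ≤⟨ *-monoˡ-≤ (⁻¹-nonneg 0≤z z≉0) p ⟩
      y * z * z ⁻¹    ≈⟨ undo y ⟩
      y               ∎
      where
      undo : ∀ w → w * z * z ⁻¹ ≈ w
      undo w = begin-equality
        w * z * z ⁻¹    ≈⟨ *-assoc w z (z ⁻¹) ⟩
        w * (z * z ⁻¹)  ≈⟨ *-congˡ (⁻¹-inverseʳ z≉0) ⟩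
        w * 1#          ≈⟨ *-identityʳ w ⟩
        w               ∎

    square-cancel-≤ : ∀ {x y} → 0# ≤ y → x * x ≤ y * y → x ≤ y
    square-cancel-≤ {x} {y} 0≤y x²≤y² with total x y
    ... | inj₁ x≤y = x≤y
    ... | inj₂ y≤x with em {x ≈ 0#}
    ...   | yes x≈0 = ≤-trans (≤-reflexive x≈0) 0≤y
    ...   | no  x≉0 = *-cancelʳ-≤ (≤-trans 0≤y y≤x) x≉0 (begin
      x * x  ≤⟨ x²≤y² ⟩
      y * y  ≤⟨ *-monoˡ-≤ 0≤y y≤x ⟩
      x * y  ≈⟨ *-comm x y ⟩
      y * x  ∎)

    √-square : ∀ {x} → 0# ≤ x → √ x * √ x ≈ x
    √-square {x} 0≤x = [ case≤ , case≥ ]′ (total (s * s) x)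
      where
      open NatSolver commutativeSemiring

      s = √ x
      c = 1# + x
      D = c + s
      N = x + s * c
      t = N * D ⁻¹

      0≤s = √-nonneg x

      1≤c : 1# ≤ c
      1≤c = ≤-trans (x≤y+x 0≤x) (≤-reflexive (+-comm x 1#))

      0≤c = ≤-trans 0≤1 1≤c

      1≤D : 1# ≤ D
      1≤D = ≤-trans 1≤c (≤-trans (x≤y+x 0≤s) (≤-reflexive (+-comm s c)))

      0≤D = ≤-trans 0≤1 1≤D

      D≉0 : ¬ D ≈ 0#
      D≉0 D≈0 = 0≉1 (antisym 0≤1 (≤-trans 1≤D (≤-reflexive D≈0)))

      x≤c² : x ≤ c * c
      x≤c² = ≤-trans (x≤y+x 0≤1) (x≤x*x 1≤c)

      0≤t : 0# ≤ t
      0≤t = *-nonneg (≤-trans 0≤x (≤-trans (x≤y+x (*-nonneg 0≤s 0≤c)) (≤-reflexive (+-comm _ x))))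
                     (⁻¹-nonneg 0≤D D≉0)

      tD≈N : t * D ≈ N
      tD≈N = begin-equality
        N * D ⁻¹ * D    ≈⟨ *-assoc N (D ⁻¹) D ⟩
        N * (D ⁻¹ * D)  ≈⟨ *-congˡ (*-comm (D ⁻¹) D) ⟩
        N * (D * D ⁻¹)  ≈⟨ *-congˡ (⁻¹-inverseʳ D≉0) ⟩
        N * 1#          ≈⟨ *-identityʳ N ⟩
        N               ∎

      t²D²≈N² : t * t * (D * D) ≈ N * N
      t²D²≈N² = begin-equality
        t * t * (D * D)    ≈⟨ solve 2 (λ t d → t :* t :* (d :* d) := t :* d :* (t :* d)) ≈-refl t D ⟩
        t * D * (t * D)    ≈⟨ *-cong tD≈N tD≈N ⟩
        N * N              ∎

      v = c * c - x

      0≤v : 0# ≤ v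
      0≤v = x≤y⇒0≤y-x x≤c²

      0≤D² = *-nonneg 0≤D 0≤D

      D²≉0 : ¬ D * D ≈ 0#
      D²≉0 e = 0≉1 (antisym 0≤1 (≤-trans 1≤D (≤-trans (x≤x*x 1≤D) (≤-reflexive e))))

      c²≈v+x : c * c ≈ v + x
      c²≈v+x = ≈-sym ([y-x]+x≈y x (c * c))

      M = x * x + s * s * x + (x * (s * c) + x * (s * c))

      N²≈ : N * N ≈ s * s * v + M
      N²≈ = begin-equality
        N * N
          ≈⟨ solve 3 (λ x s c → (x :+ s :* c) :* (x :+ s :* c) :=
                       s :* s :* (c :* c) :+ (x :* x :+ (x :* (s :* c) :+ x :* (s :* c)))) ≈-refl x s c ⟩
        s * s * (c * c) + (x * x + (x * (s * c) + x * (s * c)))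
          ≈⟨ +-congʳ (*-congˡ c²≈v+x) ⟩
        s * s * (v + x) + (x * x + (x * (s * c) + x * (s * c)))
          ≈⟨ solve 4 (λ x s c v → s :* s :* (v :+ x) :+ (x :* x :+ (x :* (s :* c) :+ x :* (s :* c))) :=
                       s :* s :* v :+ (x :* x :+ s :* s :* x :+ (x :* (s :* c) :+ x :* (s :* c)))) ≈-refl x s c v ⟩
        s * s * v + M ∎

      xD²≈ : x * (D * D) ≈ x * v + M
      xD²≈ = begin-equality
        x * (D * D)
          ≈⟨ solve 3 (λ x s c → x :* ((c :+ s) :* (c :+ s)) :=
                       x :* (c :* c) :+ (s :* s :* x :+ (x :* (s :* c) :+ x :* (s :* c)))) ≈-refl x s c ⟩
        x * (c * c) + (s * s * x + (x * (s * c) + x * (s * c)))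
          ≈⟨ +-congʳ (*-congˡ c²≈v+x) ⟩
        x * (v + x) + (s * s * x + (x * (s * c) + x * (s * c)))
          ≈⟨ solve 4 (λ x s c v → x :* (v :+ x) :+ (s :* s :* x :+ (x :* (s :* c) :+ x :* (s :* c))) :=
                       x :* v :+ (x :* x :+ s :* s :* x :+ (x :* (s :* c) :+ x :* (s :* c)))) ≈-refl x s c v ⟩
        x * v + M ∎

      sD≈ : s * D ≈ s * s + s * c
      sD≈ = solve 2 (λ s c → s :* (c :+ s) := s :* s :+ s :* c) ≈-refl s c

      case≤ : s * s ≤ x → s * s ≈ x
      case≤ s²≤x = antisym s²≤x (+-cancelʳ-≤ (s * c) (begin
        N              ≈⟨ tD≈N ⟨
        t * D          ≤⟨ *-monoˡ-≤ 0≤D (proj₁ (proj₂ (√-supremum x)) t (inj₂ t²≤x)) ⟩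
        s * D          ≈⟨ sD≈ ⟩
        s * s + s * c  ∎))
        where
        t²≤x : t * t ≤ x
        t²≤x = *-cancelʳ-≤ 0≤D² D²≉0 (begin
          t * t * (D * D)  ≈⟨ t²D²≈N² ⟩
          N * N            ≈⟨ N²≈ ⟩
          s * s * v + M    ≤⟨ +-monoˡ-≤ M (*-monoˡ-≤ 0≤v s²≤x) ⟩
          x * v + M        ≈⟨ xD²≈ ⟨
          x * (D * D)      ∎)

      case≥ : x ≤ s * s → s * s ≈ x
      case≥ x≤s² = antisym (+-cancelʳ-≤ (s * c) (begin
        s * s + s * c  ≈⟨ sD≈ ⟨
        s * D          ≤⟨ *-monoˡ-≤ 0≤D (proj₂ (proj₂ (√-supremum x)) t t-bound) ⟩
        t * D          ≈⟨ tD≈N ⟩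
        N              ∎)) x≤s²
        where
        x≤t² : x ≤ t * t
        x≤t² = *-cancelʳ-≤ 0≤D² D²≉0 (begin
          x * (D * D)      ≈⟨ xD²≈ ⟩
          x * v + M        ≤⟨ +-monoˡ-≤ M (*-monoˡ-≤ 0≤v x≤s²) ⟩
          s * s * v + M    ≈⟨ N²≈ ⟨
          N * N            ≈⟨ t²D²≈N² ⟨
          t * t * (D * D)  ∎)

        t-bound : UpperBound (Below√ x) t
        t-bound y (inj₁ y≤0)  = ≤-trans y≤0 0≤t
        t-bound y (inj₂ y²≤x) = square-cancel-≤ 0≤t (≤-trans y²≤x x≤t²)

-- Bijections of S modulo pointwise equality, with composition
-- g ∙ f = g ∘ f.
SymmetricGroup : Setoid 0ℓ 0ℓ → Group 0ℓ 0ℓ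
SymmetricGroup S = record
  { Carrier = Inverse S S
  ; _≈_     = λ f g → ∀ x → Inverse.to f x ≈ Inverse.to g x
  ; _∙_     = λ g f → Composition.inverse f g
  ; ε       = Identity.inverse S
  ; _⁻¹     = Symmetry.inverse
  ; isGroup = record
    { isMonoid = record
      { isSemigroup = record
        { isMagma = record
          { isEquivalence = record
            { refl  = λ x → S.refl
            ; sym   = λ p x → S.sym (p x)
            ; trans = λ p q x → S.trans (p x) (q x)
            }
          ; ∙-cong = λ {g} {g′} {f} {f′} p q x →
              S.trans (Inverse.to-cong g (q x)) (p (Inverse.to f′ x))
          }
        ; assoc = λ h g f x → S.refl
        }
      ; identity = (λ f x → S.refl) , (λ f x → S.refl)
      }
    ; inverse = (λ f x → Inverse.strictlyInverseʳ f x) , (λ f x → Inverse.strictlyInverseˡ f x)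
    ; ⁻¹-cong = λ {f} {g} → from-unique f g
    }
  }
  where
  module S = Setoid S
  open Setoid S using (_≈_)

  from-unique : (f g : Inverse S S) → (∀ x → Inverse.to f x ≈ Inverse.to g x) →
                ∀ x → Inverse.from f x ≈ Inverse.from g x
  from-unique f g p x = S.trans
    (Inverse.from-cong f (S.trans (S.sym (Inverse.strictlyInverseˡ g x)) (S.sym (p (Inverse.from g x)))))
    (Inverse.strictlyInverseʳ f (Inverse.from g x))

module InvariantMeasures (ℝ : CompleteOrderedField) (G : Group 0ℓ 0ℓ) where
  private module ℝ = CompleteOrderedField ℝ
  open Group G using (Carrier; _≈_; _∙_) renaming (trans to ≈-trans; sym to ≈-sym)

  -- Subsets of the setoid underlying G.
  record Event : Set₁ where
    field
      holds    : Pred Carrier 0ℓ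
      respects : holds Respects _≈_

  open Event public

  infixr 7 _⋆_
  infixr 6 _∪ᵉ_

  certain : Event
  certain = record { holds = U ; respects = λ _ _ → _ }

  _∪ᵉ_ : Event → Event → Event
  E ∪ᵉ F = record
    { holds    = holds E ∪ holds F
    ; respects = λ { p (inj₁ e) → inj₁ (respects E p e) ; p (inj₂ f) → inj₂ (respects F p f) }
    }

  -- The translate gE = { gh | h ∈ E }.
  _⋆_ : Carrier → Event → Event
  g ⋆ E = record
    { holds    = λ k → ∃ λ h → holds E h × k ≈ g ∙ h
    ; respects = λ { p (h , e , q) → h , e , ≈-trans (≈-sym p) q }
    }

  record InvariantMeasure : Set₁ where
    field
      μ              : Event → ℝ.Carrier
      μ-cong         : ∀ E F → holds E ≐ holds F → μ E ℝ.≈ μ F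
      μ-nonneg       : ∀ E → ℝ.0# ℝ.≤ μ E
      μ-certain      : μ certain ℝ.≈ ℝ.1#
      μ-additive     : ∀ E F → Empty (holds E ∩ holds F) → μ (E ∪ᵉ F) ℝ.≈ μ E ℝ.+ μ F
      left-invariant : ∀ g E → μ (g ⋆ E) ℝ.≈ μ E

module EuclideanPlane (ℝ : CompleteOrderedField) where
  open CompleteOrderedField ℝ
    using (Carrier; _≈_; _+_; _-_; _*_; 1#; +-cong; *-cong; -‿cong; setoid)
    renaming (trans to ≈-trans; sym to ≈-sym)
  open Reals ℝ using (√_; √-cong)

  ℂ : Setoid 0ℓ 0ℓ
  ℂ = ×-setoid setoid setoid

  module ℂ = Setoid ℂ

  dist : ℂ.Carrier → ℂ.Carrier → Carrier
  dist (a₁ , a₂) (b₁ , b₂) = √ ((a₁ - b₁) * (a₁ - b₁) + (a₂ - b₂) * (a₂ - b₂))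

  dist-cong : ∀ {A A′ B B′} → A ℂ.≈ A′ → B ℂ.≈ B′ → dist A B ≈ dist A′ B′
  dist-cong (p₁ , p₂) (q₁ , q₂) =
    √-cong (+-cong (*-cong (+-cong p₁ (-‿cong q₁)) (+-cong p₁ (-‿cong q₁)))
                   (*-cong (+-cong p₂ (-‿cong q₂)) (+-cong p₂ (-‿cong q₂))))

  record Isometry : Set where
    field
      bijection : Inverse ℂ ℂ
    open Inverse bijection public
    field
      isometric : ∀ A B → dist (to A) (to B) ≈ dist A B

  E₂ : Group 0ℓ 0ℓ
  E₂ = record
    { Carrier = Isometry
    ; _≈_     = λ S T → bijection S Sym.≈ bijection T
    ; _∙_     = λ S T → record
      { bijection = bijection S Sym.∙ bijection T
      ; isometric = λ A B → ≈-trans (isometric S (to T A) (to T B)) (isometric T A B)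
      }
    ; ε       = record
      { bijection = Sym.ε
      ; isometric = λ A B → dist-cong ℂ.refl ℂ.refl
      }
    ; _⁻¹     = λ T → record
      { bijection = bijection T Sym.⁻¹
      ; isometric = λ A B → ≈-trans
          (≈-sym (isometric T (from T A) (from T B)))
          (dist-cong (strictlyInverseˡ T A) (strictlyInverseˡ T B))
      }
    ; isGroup = record
      { isMonoid = record
        { isSemigroup = record
          { isMagma = record
            { isEquivalence = record
              { refl  = λ {T} → Sym.refl {bijection T}
              ; sym   = λ {S} {T} → Sym.sym {bijection S} {bijection T}
              ; trans = λ {R} {S} {T} → Sym.trans {bijection R} {bijection S} {bijection T}
              }
            ; ∙-cong = λ {S} {S′} {T} {T′} →
                Sym.∙-cong {bijection S} {bijection S′} {bijection T} {bijection T′}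
            }
          ; assoc = λ R S T → Sym.assoc (bijection R) (bijection S) (bijection T)
          }
        ; identity = (λ T → Sym.identityˡ (bijection T)) , (λ T → Sym.identityʳ (bijection T))
        }
      ; inverse = (λ T → Sym.inverseˡ (bijection T)) , (λ T → Sym.inverseʳ (bijection T))
      ; ⁻¹-cong = λ {S} {T} → Sym.⁻¹-cong {bijection S} {bijection T}
      }
    }
    where
    open Isometry
    module Sym = Group (SymmetricGroup ℂ)

  Colours : Setoid 0ℓ 0ℓ
  Colours = ≡.setoid (Fin 4)

  S₄ : Group 0ℓ 0ℓ
  S₄ = SymmetricGroup Colours

  S₄×E₂ : Group 0ℓ 0ℓ
  S₄×E₂ = DirectProduct.group S₄ E₂

  open InvariantMeasures ℝ S₄×E₂ public

  Colouring : Set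
  Colouring = Func ℂ Colours

  Proper : Colouring → Set
  Proper c = ∀ A B → dist A B ≈ 1# → Func.to c A ≢ Func.to c B

  -- The random colouring σ ∘ c₀ ∘ T⁻¹.
  recolour : Colouring → Group.Carrier S₄×E₂ → Colouring
  recolour c₀ (σ , T) = record
    { to   = λ A → Inverse.to σ (Func.to c₀ (Isometry.from T A))
    ; cong = λ A≈B → cong (Inverse.to σ) (Func.cong c₀ (Isometry.from-cong T A≈B))
    }

  -- The event { (σ , T) | c(A) = c(B) }, where c = σ ∘ c₀ ∘ T⁻¹.
  monochromatic : Colouring → ℂ.Carrier → ℂ.Carrier → Event
  monochromatic c₀ A B = record
    { holds    = λ g → Func.to (recolour c₀ g) A ≡ Func.to (recolour c₀ g) B
    ; respects = λ {g} {h} g≈h e →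
        trans (sym (recolour-cong g h g≈h A)) (trans e (recolour-cong g h g≈h B))
    }
    where
    recolour-cong : ∀ g h → Group._≈_ S₄×E₂ g h →
                    ∀ C → Func.to (recolour c₀ g) C ≡ Func.to (recolour c₀ h) C
    recolour-cong (σ , S) (τ , T) (σ≈τ , S≈T) C = trans
      (cong (Inverse.to σ) (Func.cong c₀ (Group.⁻¹-cong E₂ {S} {T} S≈T C)))
      (σ≈τ (Func.to c₀ (Isometry.from T C)))

{-# OPTIONS --safe #-}
-- Let p(x) be the probability that two points at distance x get the same
-- colour.
--
-- p(x) ≤ 27/56 for all x ≥ 1/2.  Some rotation e about the origin moves the
-- points at distance x from it by exactly 1, so p(x) ≤ 1/2, and if p(x) is
-- close to 1/2 then almost always exactly one of z and ez has the colour of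
-- 0.  Then an equilateral triangle 0, z, ωz of side x with c(z) = c(ωz) ≠ c(0)
-- is rare: rotating 0 about z and about ωz gives the unit triangle 0, (1 - e)z,
-- (1 - e)ωz, and the last two points cannot both have the colour c(z).
-- Precisely, the probability of such a triangle is at most 1 - 2p(x).  In the
-- half hexagon z, ωz, ω²z, ω³z around 0 this leaves two main cases: all points
-- have the colour of 0, or none has it and neighbours differ, so that two
-- non-neighbours among four points with three colours agree.  Both force
-- coincidences at the distances √3 x and 2x, which have probability at most 1/2.
--
-- On the axes of the unit triangle 0, 1, ω through 0 and through 1, let X and Y
-- be the points at signed distances r and √3 - r from these vertices, where
-- r² - √3 r + 1 = d².  Then X is at distance d from 1, ω and Y, and Y is at
-- distance d from 0 and ω.  With four colours, X or Y shares its colour with a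
-- vertex or c(X) = c(Y), so 1 ≤ 5 p(d) + p(|r|) + p(√3 - r).  For d as in the
-- theorem r can be chosen with |r|, √3 - r ≥ 1/2, and then p(d) ≥ 1/140.
module Submission where

open import Algebra.Bundles using (AbelianGroup; CommutativeRing; Group; RawRing)
import Algebra.Construct.DirectProduct as DirectProduct
import Algebra.Properties.AbelianGroup as AbelianGroupProperties
import Algebra.Properties.CommutativeSemigroup as CommutativeSemigroupProperties
import Algebra.Properties.Ring as RingProperties
import Algebra.Properties.Semiring.Mult.TCOptimised as Mult
import Algebra.Solver.Ring
open import Algebra.Solver.Ring.AlmostCommutativeRing
  using (fromCommutativeRing; _-Raw-AlmostCommutative⟶_; Induced-equivalence)
open import Axiom.ExcludedMiddle using (ExcludedMiddle)
open import Data.Bool.Base using (Bool; true; false; not; _∧_; T; if_then_else_)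
open import Data.Empty using (⊥-elim)
open import Data.Fin.Base using (Fin)
open import Data.Fin.Properties using (_≟_; all?)
open import Data.List.Base using (List; []; _∷_)
open import Data.List.Relation.Binary.Pointwise.Base using ([]; _∷_) renaming (Pointwise to Listwise)
open import Data.Maybe.Base using (just; nothing)
open import Data.Nat.Base as ℕ using (ℕ)
import Data.Nat.Properties as ℕ
open import Data.Product.Base using (∃; _×_; _,_; proj₁; proj₂)
open import Data.Sum.Base using (_⊎_; inj₁; inj₂)
open import Data.Unit.Base using (tt)
open import Data.Vec.Base using (Vec; []; _∷_; map)
open import Data.Vec.Properties using (map-cong)
open import Data.Vec.Relation.Binary.Pointwise.Inductive using (Pointwise; []; _∷_)
open import Defs
open import Function.Bundles using (Func; Inverse)
open import Level using (0ℓ)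
open import Relation.Binary.Bundles using (Poset)
open import Relation.Binary.Definitions using (WeaklyDecidable)
open import Relation.Binary.PropositionalEquality.Core as ≡ using (_≡_; _≢_; cong; subst)
import Relation.Binary.Reasoning.PartialOrder as PosetReasoning
import Relation.Binary.Reasoning.Setoid as SetoidReasoning
open import Relation.Nullary.Decidable using (Dec; True; toWitness; fromWitness; yes; no; ⌊_⌋; ¬?; _→-dec_)
open import Relation.Nullary.Negation.Core using (¬_)

-- Polynomial identities with integer coefficients in a commutative ring

-- The integer m - n is represented by the pair (m , n), one of whose
-- components is kept zero so that normal forms are unique.
module RingSolver (R : CommutativeRing 0ℓ 0ℓ) where
  open CommutativeRing R
  open Mult semiring using (×-homo-+; ×1-homo-*) renaming (_×_ to _×ᵐ_)
  open RingProperties ring using (-0#≈0#; -‿involutive; -‿distribˡ-*; -‿distribʳ-*)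
  open AbelianGroupProperties +-abelianGroup using () renaming (⁻¹-∙-comm to -x-y≈-[x+y])
  open CommutativeSemigroupProperties +-commutativeSemigroup using (interchange)
  open SetoidReasoning setoid

  private
    reduce : ℕ × ℕ → ℕ × ℕ
    reduce (a , b) = a ℕ.∸ b , b ℕ.∸ a

    differences : RawRing 0ℓ 0ℓ
    differences = record
      { Carrier = ℕ × ℕ
      ; _≈_     = _≡_
      ; _+_     = λ (a , b) (c , d) → reduce (a ℕ.+ c , b ℕ.+ d)
      ; _*_     = λ (a , b) (c , d) → reduce (a ℕ.* c ℕ.+ b ℕ.* d , a ℕ.* d ℕ.+ b ℕ.* c)
      ; -_      = λ (a , b) → b , a
      ; 0#      = 0 , 0
      ; 1#      = 1 , 0
      }

    ν : ℕ → Carrier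
    ν n = n ×ᵐ 1#

    -- The case distinction makes (n , 0) denote ν n on the nose.
    ⟦_⟧ : ℕ × ℕ → Carrier
    ⟦ a , ℕ.zero  ⟧ = ν a
    ⟦ a , ℕ.suc b ⟧ = ν a - ν (ℕ.suc b)

    ⟦_⟧≈ : ∀ ((a , b) : ℕ × ℕ) → ⟦ a , b ⟧ ≈ ν a - ν b
    ⟦ a , ℕ.zero  ⟧≈ = sym (trans (+-congˡ -0#≈0#) (+-identityʳ (ν a)))
    ⟦ a , ℕ.suc b ⟧≈ = refl

    [x+y]-[z+w] : ∀ x y z w → (x + y) - (z + w) ≈ (x - z) + (y - w)
    [x+y]-[z+w] x y z w = begin
      (x + y) - (z + w)      ≈⟨ +-congˡ (-x-y≈-[x+y] z w) ⟨
      (x + y) + (- z + - w)  ≈⟨ interchange x y (- z) (- w) ⟩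
      (x - z) + (y - w)      ∎

    -- Pairs that are equal as formal differences denote equal ring elements.
    x+w≈y+z⇒x-z≈y-w : ∀ {x y z w} → x + w ≈ y + z → x - z ≈ y - w
    x+w≈y+z⇒x-z≈y-w {x} {y} {z} {w} eq = begin
      x - z                ≈⟨ +-identityʳ (x - z) ⟨
      (x - z) + 0#         ≈⟨ +-congˡ (-‿inverseʳ w) ⟨
      (x - z) + (w - w)    ≈⟨ [x+y]-[z+w] x w z w ⟨
      (x + w) - (z + w)    ≈⟨ +-cong eq (-‿cong (+-comm z w)) ⟩
      (y + z) - (w + z)    ≈⟨ [x+y]-[z+w] y z w z ⟩
      (y - w) + (z - z)    ≈⟨ +-congˡ (-‿inverseʳ z) ⟩
      (y - w) + 0#         ≈⟨ +-identityʳ (y - w) ⟩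
      y - w                ∎

    -- Both sides are the maximum of `a` and `b`, so reducing a pair does not change the difference
    -- that it represents.
    ∸-swap : ∀ a b → a ℕ.∸ b ℕ.+ b ≡ a ℕ.+ (b ℕ.∸ a)
    ∸-swap ℕ.zero    ℕ.zero    = ≡.refl
    ∸-swap ℕ.zero    (ℕ.suc b) = ≡.refl
    ∸-swap (ℕ.suc a) ℕ.zero    = ≡.refl
    ∸-swap (ℕ.suc a) (ℕ.suc b) = ≡.trans (ℕ.+-suc (a ℕ.∸ b) b) (cong ℕ.suc (∸-swap a b))

    ⟦reduce⟧≈ : ∀ ((a , b) : ℕ × ℕ) → ⟦ reduce (a , b) ⟧ ≈ ν a - ν b
    ⟦reduce⟧≈ (a , b) = trans ⟦ reduce (a , b) ⟧≈ (x+w≈y+z⇒x-z≈y-w (begin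
      ν (a ℕ.∸ b) + ν b    ≈⟨ ×-homo-+ 1# (a ℕ.∸ b) b ⟨
      ν (a ℕ.∸ b ℕ.+ b)    ≡⟨ cong ν (∸-swap a b) ⟩
      ν (a ℕ.+ (b ℕ.∸ a))  ≈⟨ ×-homo-+ 1# a (b ℕ.∸ a) ⟩
      ν a + ν (b ℕ.∸ a)    ∎))

    [x-y]*[z-w] : ∀ x y z w → (x - y) * (z - w) ≈ (x * z + y * w) - (x * w + y * z)
    [x-y]*[z-w] x y z w = begin
      (x - y) * (z - w)
        ≈⟨ distribˡ (x - y) z (- w) ⟩
      (x - y) * z + (x - y) * - w
        ≈⟨ +-cong (distribʳ z x (- y)) (distribʳ (- w) x (- y)) ⟩
      (x * z + - y * z) + (x * - w + - y * - w)
        ≈⟨ +-cong (+-congˡ (sym (-‿distribˡ-* y z))) (trans (+-comm _ _) (+-cong neg-neg (sym (-‿distribʳ-* x w)))) ⟩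
      (x * z - y * z) + (y * w - x * w)
        ≈⟨ interchange (x * z) (- (y * z)) (y * w) (- (x * w)) ⟩
      (x * z + y * w) + (- (y * z) - x * w)
        ≈⟨ +-congˡ (trans (+-comm _ _) (-x-y≈-[x+y] (x * w) (y * z))) ⟩
      (x * z + y * w) - (x * w + y * z)
        ∎
      where
      neg-neg : - y * - w ≈ y * w
      neg-neg = trans (sym (-‿distribˡ-* y (- w))) (trans (-‿cong (sym (-‿distribʳ-* y w))) (-‿involutive (y * w)))

    morphism : differences -Raw-AlmostCommutative⟶ fromCommutativeRing R
    morphism = record
      { ⟦_⟧    = ⟦_⟧
      ; +-homo = λ (a , b) (c , d) → begin
          ⟦ reduce (a ℕ.+ c , b ℕ.+ d) ⟧  ≈⟨ ⟦reduce⟧≈ (a ℕ.+ c , b ℕ.+ d) ⟩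
          ν (a ℕ.+ c) - ν (b ℕ.+ d)      ≈⟨ +-cong (×-homo-+ 1# a c) (-‿cong (×-homo-+ 1# b d)) ⟩
          (ν a + ν c) - (ν b + ν d)      ≈⟨ [x+y]-[z+w] (ν a) (ν c) (ν b) (ν d) ⟩
          (ν a - ν b) + (ν c - ν d)      ≈⟨ +-cong ⟦ a , b ⟧≈ ⟦ c , d ⟧≈ ⟨
          ⟦ a , b ⟧ + ⟦ c , d ⟧          ∎
      ; *-homo = λ (a , b) (c , d) → begin
          ⟦ reduce (a ℕ.* c ℕ.+ b ℕ.* d , a ℕ.* d ℕ.+ b ℕ.* c) ⟧
            ≈⟨ ⟦reduce⟧≈ (a ℕ.* c ℕ.+ b ℕ.* d , a ℕ.* d ℕ.+ b ℕ.* c) ⟩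
          ν (a ℕ.* c ℕ.+ b ℕ.* d) - ν (a ℕ.* d ℕ.+ b ℕ.* c)
            ≈⟨ +-cong (homo a c b d) (-‿cong (homo a d b c)) ⟩
          (ν a * ν c + ν b * ν d) - (ν a * ν d + ν b * ν c)
            ≈⟨ [x-y]*[z-w] (ν a) (ν b) (ν c) (ν d) ⟨
          (ν a - ν b) * (ν c - ν d)
            ≈⟨ *-cong ⟦ a , b ⟧≈ ⟦ c , d ⟧≈ ⟨
          ⟦ a , b ⟧ * ⟦ c , d ⟧
            ∎
      ; -‿homo = λ (a , b) → begin
          ⟦ b , a ⟧          ≈⟨ ⟦ b , a ⟧≈ ⟩
          ν b - ν a          ≈⟨ +-comm (ν b) (- ν a) ⟩
          - ν a + ν b        ≈⟨ +-congˡ (-‿involutive (ν b)) ⟨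
          - ν a + - (- ν b)  ≈⟨ -x-y≈-[x+y] (ν a) (- ν b) ⟩
          - (ν a - ν b)      ≈⟨ -‿cong ⟦ a , b ⟧≈ ⟨
          - ⟦ a , b ⟧        ∎
      ; 0-homo = refl
      ; 1-homo = refl
      }
      where
      homo : ∀ m n o p → ν (m ℕ.* n ℕ.+ o ℕ.* p) ≈ ν m * ν n + ν o * ν p
      homo m n o p = trans (×-homo-+ 1# (m ℕ.* n) (o ℕ.* p)) (+-cong (×1-homo-* m n) (×1-homo-* o p))

    _≟ᶜ_ : WeaklyDecidable (Induced-equivalence morphism)
    (a , b) ≟ᶜ (c , d) with a ℕ.+ d ℕ.≟ c ℕ.+ b
    ... | no  _  = nothing
    ... | yes eq = just (begin
      ⟦ a , b ⟧  ≈⟨ ⟦ a , b ⟧≈ ⟩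
      ν a - ν b  ≈⟨ x+w≈y+z⇒x-z≈y-w (trans (sym (×-homo-+ 1# a d)) (trans (reflexive (cong ν eq)) (×-homo-+ 1# c b))) ⟩
      ν c - ν d  ≈⟨ ⟦ c , d ⟧≈ ⟨
      ⟦ c , d ⟧  ∎)

  open Algebra.Solver.Ring differences (fromCommutativeRing R) morphism _≟ᶜ_ public
    using (Polynomial; solve; _:=_; _:+_; _:*_; _:-_; :-_; con)

  κ : ∀ {m} → ℕ → Polynomial m
  κ n = con (n , 0)

  -- Denotes n × 1# for the unoptimised multiple _×_ of the standard library.
  :# : ∀ {m} → ℕ → Polynomial m
  :# ℕ.zero    = κ 0
  :# (ℕ.suc n) = κ 1 :+ :# n

  -- Derives an equation from a relation `a ≈ b`: with a suitable cofactor `k` the last hypothesis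
  -- is a polynomial identity, which `solve` can prove. Nested uses reduce modulo several relations.
  modulo : ∀ {x y a b} k → a ≈ b → x ≈ y + k * (a - b) → x ≈ y
  modulo {x} {y} {a} {b} k a≈b eq = trans eq (trans (+-congˡ (*-congˡ (+-congʳ a≈b)))
    (solve 3 (λ y k b → y :+ k :* (b :- b) := y) refl y k b))

-- Complex numbers over a commutative ring

module Complex (R : CommutativeRing 0ℓ 0ℓ) where
  open CommutativeRing R
  open RingSolver R

  complexRing : CommutativeRing 0ℓ 0ℓ
  complexRing = record
    { _*_ = λ (a , b) (c , d) → a * c - b * d , a * d + b * c
    ; 1#  = 1# , 0#
    ; isCommutativeRing = record
      { isRing = record
        { +-isAbelianGroup = AbelianGroup.isAbelianGroup (DirectProduct.abelianGroup +-abelianGroup +-abelianGroup)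
        ; *-cong     = λ (p , q) (r , s) →
            +-cong (*-cong p r) (-‿cong (*-cong q s)) , +-cong (*-cong p s) (*-cong q r)
        ; *-assoc    = λ (a , b) (c , d) (e , f) →
            solve 6 (λ a b c d e f → (a :* c :- b :* d) :* e :- (a :* d :+ b :* c) :* f :=
                                     a :* (c :* e :- d :* f) :- b :* (c :* f :+ d :* e)) refl a b c d e f ,
            solve 6 (λ a b c d e f → (a :* c :- b :* d) :* f :+ (a :* d :+ b :* c) :* e :=
                                     a :* (c :* f :+ d :* e) :+ b :* (c :* e :- d :* f)) refl a b c d e f
        ; *-identity =
            (λ (a , b) → solve 2 (λ a b → κ 1 :* a :- κ 0 :* b := a) refl a b ,
                         solve 2 (λ a b → κ 1 :* b :+ κ 0 :* a := b) refl a b) ,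
            (λ (a , b) → solve 2 (λ a b → a :* κ 1 :- b :* κ 0 := a) refl a b ,
                         solve 2 (λ a b → a :* κ 0 :+ b :* κ 1 := b) refl a b)
        ; distrib    =
            (λ (a , b) (c , d) (e , f) →
              solve 6 (λ a b c d e f → a :* (c :+ e) :- b :* (d :+ f) :=
                                       (a :* c :- b :* d) :+ (a :* e :- b :* f)) refl a b c d e f ,
              solve 6 (λ a b c d e f → a :* (d :+ f) :+ b :* (c :+ e) :=
                                       (a :* d :+ b :* c) :+ (a :* f :+ b :* e)) refl a b c d e f) ,
            (λ (a , b) (c , d) (e , f) →
              solve 6 (λ a b c d e f → (c :+ e) :* a :- (d :+ f) :* b :=
                                       (c :* a :- d :* b) :+ (e :* a :- f :* b)) refl a b c d e f ,
              solve 6 (λ a b c d e f → (c :+ e) :* b :+ (d :+ f) :* a :=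
                                       (c :* b :+ d :* a) :+ (e :* b :+ f :* a)) refl a b c d e f)
        }
      ; *-comm = λ (a , b) (c , d) →
          solve 4 (λ a b c d → a :* c :- b :* d := c :* a :- d :* b) refl a b c d ,
          solve 4 (λ a b c d → a :* d :+ b :* c := c :* b :+ d :* a) refl a b c d
      }
    }

  module ℂ = CommutativeRing complexRing

  conj : ℂ.Carrier → ℂ.Carrier
  conj (a , b) = a , - b

  -- The squared modulus. Distances are handled through their squares, which keeps the geometry
  -- polynomial.
  N : ℂ.Carrier → Carrier
  N (a , b) = a * a + b * b

  N-cong : ∀ {z w} → z ℂ.≈ w → N z ≈ N w
  N-cong (p , q) = +-cong (*-cong p p) (*-cong q q)

  N-* : ∀ z w → N (z ℂ.* w) ≈ N z * N w
  N-* (a , b) (c , d) = solve 4 (λ a b c d →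
    (a :* c :- b :* d) :* (a :* c :- b :* d) :+ (a :* d :+ b :* c) :* (a :* d :+ b :* c) :=
    (a :* a :+ b :* b) :* (c :* c :+ d :* d)) refl a b c d

  N-conj : ∀ z → N (conj z) ≈ N z
  N-conj (a , b) = solve 2 (λ a b → a :* a :+ (:- b) :* (:- b) := a :* a :+ b :* b) refl a b

  N-neg : ∀ z → N (ℂ.- z) ≈ N z
  N-neg (a , b) = solve 2 (λ a b → (:- a) :* (:- a) :+ (:- b) :* (:- b) := a :* a :+ b :* b) refl a b

  *-conj : ∀ z → z ℂ.* conj z ℂ.≈ (N z , 0#)
  *-conj (a , b) = solve 2 (λ a b → a :* a :- b :* (:- b) := a :* a :+ b :* b) refl a b ,
                   solve 2 (λ a b → a :* (:- b) :+ b :* a := κ 0) refl a b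

-- Ordered field arithmetic

module OrderedField (ℝ : CompleteOrderedField) where
  open CompleteOrderedField ℝ
  open Reals ℝ
  open RingSolver commutativeRing
  open Mult semiring using (×-homo-+; ×ᵤ≈×) renaming (_×_ to _×ᵐ_)

  poset : Poset 0ℓ 0ℓ 0ℓ
  poset = record { isPartialOrder = isPartialOrder }

  open PosetReasoning poset

  -- The optimised multiple, which the solver constant `κ n` denotes; the numeral `# n` of the
  -- statement is denoted by `:# n`.
  ν : ℕ → Carrier
  ν n = n ×ᵐ 1#

  +-mono-≤ : ∀ {x y u v} → x ≤ y → u ≤ v → x + u ≤ y + v
  +-mono-≤ {x} {y} {u} {v} x≤y u≤v = begin
    x + u  ≤⟨ +-monoˡ-≤ u x≤y ⟩
    y + u  ≈⟨ +-comm y u ⟩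
    u + y  ≤⟨ +-monoˡ-≤ y u≤v ⟩
    v + y  ≈⟨ +-comm v y ⟩
    y + v  ∎

  +-nonneg : ∀ {x y} → 0# ≤ x → 0# ≤ y → 0# ≤ x + y
  +-nonneg {x} {y} 0≤x 0≤y = ≤-trans 0≤y (x≤y+x 0≤x)

  ν-nonneg : ∀ n → 0# ≤ ν n
  ν-nonneg ℕ.zero    = ≤-refl
  ν-nonneg (ℕ.suc n) = ≤-trans (+-nonneg 0≤1 (ν-nonneg n)) (≤-reflexive (sym (×-homo-+ 1# 1 n)))

  ν-mono-≤ : ∀ {m n} → m ℕ.≤ n → ν m ≤ ν n
  ν-mono-≤ {m} {n} m≤n = begin
    ν m                  ≤⟨ x≤y+x (ν-nonneg (n ℕ.∸ m)) ⟩
    ν (n ℕ.∸ m) + ν m    ≈⟨ ×-homo-+ 1# (n ℕ.∸ m) m ⟨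
    ν (n ℕ.∸ m ℕ.+ m)    ≡⟨ cong ν (ℕ.m∸n+n≡m m≤n) ⟩
    ν n                  ∎

  -- The form of most inequality proofs below: `z` is an expression for the difference that is
  -- visibly nonnegative.
  0≤z≈y-x⇒x≤y : ∀ {x y z} → 0# ≤ z → z ≈ y - x → x ≤ y
  0≤z≈y-x⇒x≤y 0≤z z≈y-x = 0≤y-x⇒x≤y (≤-trans 0≤z (≤-reflexive z≈y-x))

  1≤yx⇒x≉0 : ∀ {x y} → 1# ≤ y * x → ¬ x ≈ 0#
  1≤yx⇒x≉0 {x} {y} 1≤yx x≈0 = 0≉1 (antisym 0≤1 (≤-trans 1≤yx (≤-reflexive (trans (*-congˡ x≈0) (zeroʳ y)))))

  -- The hypothesis is the recurring form of √D ≥ 1/2: a circle of squared radius `D` has a chord of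
  -- length 1.
  1≤4x⇒0≤x : ∀ {D} → 1# ≤ ν 4 * D → 0# ≤ D
  1≤4x⇒0≤x {D} 1≤4D with total 0# D
  ... | inj₁ p = p
  ... | inj₂ p = ⊥-elim (0≉1 (antisym 0≤1 (≤-trans 1≤4D
    (0≤z≈y-x⇒x≤y (*-nonneg (ν-nonneg 4) (0≤-x p)) (solve 1 (λ d → κ 4 :* (:- d) := κ 0 :- κ 4 :* d) refl D)))))


  #≈ν : ∀ n → # n ≈ ν n
  #≈ν n = ×ᵤ≈× n 1#

  #-nonneg : ∀ n → 0# ≤ # n
  #-nonneg n = ≤-trans (ν-nonneg n) (≤-reflexive (sym (#≈ν n)))

  ν-nonzero : ∀ n → ¬ ν (ℕ.suc n) ≈ 0#
  ν-nonzero n = 1≤yx⇒x≉0 {y = 1#} (≤-trans (ν-mono-≤ {1} {ℕ.suc n} (ℕ.s≤s ℕ.z≤n)) (≤-reflexive (sym (*-identityˡ _))))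

  #-nonzero : ∀ n → ¬ # (ℕ.suc n) ≈ 0#
  #-nonzero n eq = ν-nonzero n (trans (sym (#≈ν (ℕ.suc n))) eq)

  square-nonneg : ∀ x → 0# ≤ x * x
  square-nonneg x with total 0# x
  ... | inj₁ 0≤x = *-nonneg 0≤x 0≤x
  ... | inj₂ x≤0 = ≤-trans (*-nonneg (0≤-x x≤0) (0≤-x x≤0))
    (≤-reflexive (solve 1 (λ x → (:- x) :* (:- x) := x :* x) refl x))

-- Finitely additive probability and expectations of counts

module DecidableEvents (ℝ : CompleteOrderedField) (G : Group 0ℓ 0ℓ)
                       (𝝁 : InvariantMeasures.InvariantMeasure ℝ G) where
  open CompleteOrderedField ℝ
  open Reals ℝ
  open OrderedField ℝ
  open RingSolver commutativeRing
  open Mult semiring using (×-homo-+)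
  open CommutativeSemigroupProperties +-commutativeSemigroup using (interchange)
  open PosetReasoning poset
  private module G = Group G
  open InvariantMeasures ℝ G using (Event; holds)
  open InvariantMeasures.InvariantMeasure 𝝁

  -- Events given by Boolean functions, so that indicators and case distinctions compute.
  record Test : Set where
    field
      test     : G.Carrier → Bool
      test-cong : ∀ {g h} → g G.≈ h → test g ≡ test h

  open Test public

  event : Test → Event
  event E = record
    { holds    = λ g → T (test E g)
    ; respects = λ g≈h → subst T (test-cong E g≈h)
    }

  P : Test → Carrier
  P E = μ (event E)

  ⊤ᵗ : Test
  ⊤ᵗ = record { test = λ _ → true ; test-cong = λ _ → ≡.refl }

  _∧ᵗ_ : Test → Test → Test
  E ∧ᵗ F = record
    { test      = λ g → test E g ∧ test F g
    ; test-cong = λ g≈h → ≡.cong₂ _∧_ (test-cong E g≈h) (test-cong F g≈h)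
    }

  ¬ᵗ_ : Test → Test
  ¬ᵗ E = record { test = λ g → not (test E g) ; test-cong = λ g≈h → cong not (test-cong E g≈h) }

  P-cong : ∀ E F → (∀ g → test E g ≡ test F g) → P E ≈ P F
  P-cong E F E≡F = μ-cong (event E) (event F)
    ((λ {g} → subst T (E≡F g)) , (λ {g} → subst T (≡.sym (E≡F g))))

  P-⊤ : P ⊤ᵗ ≈ 1#
  P-⊤ = trans (μ-cong (event ⊤ᵗ) (InvariantMeasures.certain ℝ G) ((λ _ → _) , (λ _ → _))) μ-certain

  ⟨_⟩ : Bool → ℕ
  ⟨ b ⟩ = if b then 1 else 0

  -- If the indicator of `E` is the sum of those of `F` and `H`, then `F` and `H` are disjoint and
  -- their union is `E`.
  P-+ : ∀ E F H → (∀ g → ⟨ test E g ⟩ ≡ ⟨ test F g ⟩ ℕ.+ ⟨ test H g ⟩) → P E ≈ P F + P H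
  P-+ E F H E≡F+H = trans
    (μ-cong (event E) _ ((λ {g} → split (test E g) (test F g) (test H g) (E≡F+H g)) ,
                         (λ {g} → unsplit (test E g) (test F g) (test H g) (E≡F+H g))))
    (μ-additive (event F) (event H) (λ g → disjoint (test E g) (test F g) (test H g) (E≡F+H g)))
    where
    split : ∀ a b c → ⟨ a ⟩ ≡ ⟨ b ⟩ ℕ.+ ⟨ c ⟩ → T a → T b ⊎ T c
    split true true  c    eq _ = inj₁ tt
    split true false true eq _ = inj₂ tt
    unsplit : ∀ a b c → ⟨ a ⟩ ≡ ⟨ b ⟩ ℕ.+ ⟨ c ⟩ → T b ⊎ T c → T a
    unsplit true  b     c    eq _        = tt
    unsplit false false true () (inj₂ _)
    disjoint : ∀ a b c → ⟨ a ⟩ ≡ ⟨ b ⟩ ℕ.+ ⟨ c ⟩ → ¬ (T b × T c)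
    disjoint true  true true () _
    disjoint false true true () _

  -- An empty event is the disjoint union of two copies of itself, so its probability equals its own
  -- double.
  P-empty : ∀ E → (∀ g → ¬ T (test E g)) → P E ≈ 0#
  P-empty E empty = begin-equality
    P E              ≈⟨ solve 1 (λ x → x := x :+ x :- x) refl (P E) ⟩
    P E + P E - P E  ≈⟨ +-congʳ (P-+ E E E (λ g → zeros (test E g) (empty g))) ⟨
    P E - P E        ≈⟨ -‿inverseʳ (P E) ⟩
    0#               ∎
    where
    zeros : ∀ b → ¬ T b → ⟨ b ⟩ ≡ ⟨ b ⟩ ℕ.+ ⟨ b ⟩
    zeros true  ¬tt = ⊥-elim (¬tt tt)
    zeros false _   = ≡.refl

  P-split : ∀ E F → P E ≈ P (E ∧ᵗ F) + P (E ∧ᵗ (¬ᵗ F))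
  P-split E F = P-+ E (E ∧ᵗ F) (E ∧ᵗ (¬ᵗ F)) (λ g → split (test E g) (test F g))
    where
    split : ∀ a b → ⟨ a ⟩ ≡ ⟨ a ∧ b ⟩ ℕ.+ ⟨ a ∧ not b ⟩
    split true  true  = ≡.refl
    split true  false = ≡.refl
    split false _     = ≡.refl

  -- A combination of indicators with natural weights. `count` is its value at a group element and
  -- `expectation H` its integral over `H`.
  Weighted : Set
  Weighted = List (ℕ × Test)

  count : Weighted → G.Carrier → ℕ
  count []            g = 0
  count ((n , E) ∷ L) g = (if test E g then n else 0) ℕ.+ count L g

  expectation : Test → Weighted → Carrier
  expectation H []            = 0#
  expectation H ((n , E) ∷ L) = ν n * P (H ∧ᵗ E) + expectation H L

  private
    swap : ∀ a b c → ⟨ a ∧ b ⟩ ≡ ⟨ (a ∧ c) ∧ b ⟩ ℕ.+ ⟨ (a ∧ not c) ∧ b ⟩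
    swap true  true  true  = ≡.refl
    swap true  true  false = ≡.refl
    swap true  false true  = ≡.refl
    swap true  false false = ≡.refl
    swap false _     _     = ≡.refl

    expectation-split : ∀ H F L → expectation H L ≈ expectation (H ∧ᵗ F) L + expectation (H ∧ᵗ (¬ᵗ F)) L
    expectation-split H F []            = sym (+-identityʳ 0#)
    expectation-split H F ((n , E) ∷ L) = trans
      (+-cong (trans (*-congˡ (P-+ (H ∧ᵗ E) ((H ∧ᵗ F) ∧ᵗ E) ((H ∧ᵗ (¬ᵗ F)) ∧ᵗ E)
                                   (λ g → swap (test H g) (test E g) (test F g))))
                     (distribˡ (ν n) _ _))
              (expectation-split H F L))
      (interchange _ _ _ _)

    -- On `E` the first weight joins the constant `a`, off `E` it disappears; either way the list
    -- gets shorter.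
    total-split : ∀ H E L a n →
      ν a * P H + expectation H ((n , E) ∷ L) ≈
      (ν (a ℕ.+ n) * P (H ∧ᵗ E) + expectation (H ∧ᵗ E) L) +
      (ν a * P (H ∧ᵗ (¬ᵗ E)) + expectation (H ∧ᵗ (¬ᵗ E)) L)
    total-split H E L a n = begin-equality
      ν a * P H + (ν n * P₁ + expectation H L)
        ≈⟨ +-cong (*-congˡ (P-split H E)) (+-congˡ (expectation-split H E L)) ⟩
      ν a * (P₁ + P₂) + (ν n * P₁ + (X₁ + X₂))
        ≈⟨ solve 6 (λ a n p q x y → a :* (p :+ q) :+ (n :* p :+ (x :+ y)) :=
                      ((a :+ n) :* p :+ x) :+ (a :* q :+ y)) refl (ν a) (ν n) P₁ P₂ X₁ X₂ ⟩
      ((ν a + ν n) * P₁ + X₁) + (ν a * P₂ + X₂)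
        ≈⟨ +-congʳ (+-congʳ (*-congʳ (×-homo-+ 1# a n))) ⟨
      (ν (a ℕ.+ n) * P₁ + X₁) + (ν a * P₂ + X₂)
        ∎
      where
      P₁ = P (H ∧ᵗ E)
      P₂ = P (H ∧ᵗ (¬ᵗ E))
      X₁ = expectation (H ∧ᵗ E) L
      X₂ = expectation (H ∧ᵗ (¬ᵗ E)) L

    on : ∀ a b n x y z → (T a → x ℕ.+ ((if b then n else 0) ℕ.+ y) ℕ.≤ z) → T (a ∧ b) → x ℕ.+ n ℕ.+ y ℕ.≤ z
    on true true n x y z p _ = subst (ℕ._≤ z) (≡.sym (ℕ.+-assoc x n y)) (p tt)

    off : ∀ a b n x y z → (T a → x ℕ.+ ((if b then n else 0) ℕ.+ y) ℕ.≤ z) → T (a ∧ not b) → x ℕ.+ y ℕ.≤ z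
    off true false n x y z p _ = p tt

    on′ : ∀ a b n x y z → (T a → z ℕ.≤ x ℕ.+ ((if b then n else 0) ℕ.+ y)) → T (a ∧ b) → z ℕ.≤ x ℕ.+ n ℕ.+ y
    on′ true true n x y z p _ = subst (z ℕ.≤_) (≡.sym (ℕ.+-assoc x n y)) (p tt)

    off′ : ∀ a b n x y z → (T a → z ℕ.≤ x ℕ.+ ((if b then n else 0) ℕ.+ y)) → T (a ∧ not b) → z ℕ.≤ x ℕ.+ y
    off′ true false n x y z p _ = p tt

  -- H is refined by the tests one at a time until both counts are constant on it.
  expectation-mono : ∀ H a b L M → (∀ g → T (test H g) → a ℕ.+ count L g ℕ.≤ b ℕ.+ count M g) →
                     ν a * P H + expectation H L ≤ ν b * P H + expectation H M
  expectation-mono H a b ((n , E) ∷ L) M p = begin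
    ν a * P H + expectation H ((n , E) ∷ L)
      ≈⟨ total-split H E L a n ⟩
    _ + _
      ≤⟨ +-mono-≤ (expectation-mono (H ∧ᵗ E) (a ℕ.+ n) b L M
                    (λ g → on (test H g) (test E g) n a (count L g) (b ℕ.+ count M g) (p g)))
                  (expectation-mono (H ∧ᵗ (¬ᵗ E)) a b L M
                    (λ g → off (test H g) (test E g) n a (count L g) (b ℕ.+ count M g) (p g))) ⟩
    (ν b * P (H ∧ᵗ E) + expectation (H ∧ᵗ E) M) + (ν b * P (H ∧ᵗ (¬ᵗ E)) + expectation (H ∧ᵗ (¬ᵗ E)) M)
      ≈⟨ interchange _ _ _ _ ⟩
    (ν b * P (H ∧ᵗ E) + ν b * P (H ∧ᵗ (¬ᵗ E))) + (expectation (H ∧ᵗ E) M + expectation (H ∧ᵗ (¬ᵗ E)) M)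
      ≈⟨ +-cong (trans (sym (distribˡ (ν b) _ _)) (*-congˡ (sym (P-split H E)))) (sym (expectation-split H E M)) ⟩
    ν b * P H + expectation H M
      ∎
  expectation-mono H a b [] ((n , E) ∷ M) p = begin
    ν a * P H + 0#
      ≈⟨ +-congʳ (*-congˡ (P-split H E)) ⟩
    ν a * (P (H ∧ᵗ E) + P (H ∧ᵗ (¬ᵗ E))) + 0#
      ≈⟨ solve 3 (λ a x y → a :* (x :+ y) :+ κ 0 := (a :* x :+ κ 0) :+ (a :* y :+ κ 0)) refl (ν a) _ _ ⟩
    (ν a * P (H ∧ᵗ E) + 0#) + (ν a * P (H ∧ᵗ (¬ᵗ E)) + 0#)
      ≤⟨ +-mono-≤ (expectation-mono (H ∧ᵗ E) a (b ℕ.+ n) [] M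
                    (λ g → on′ (test H g) (test E g) n b (count M g) (a ℕ.+ 0) (p g)))
                  (expectation-mono (H ∧ᵗ (¬ᵗ E)) a b [] M
                    (λ g → off′ (test H g) (test E g) n b (count M g) (a ℕ.+ 0) (p g))) ⟩
    _ + _
      ≈⟨ total-split H E M b n ⟨
    ν b * P H + expectation H ((n , E) ∷ M)
      ∎
  -- Both integrands are now constant on `H`. Either the constants compare as wanted, or `H` is
  -- empty and both integrals vanish.
  expectation-mono H a b [] [] p with a ℕ.≤? b
  ... | yes a≤b = +-monoˡ-≤ 0# (*-monoˡ-≤ (μ-nonneg (event H)) (ν-mono-≤ a≤b))
  ... | no  a≰b = ≤-reflexive (+-congʳ (trans (null a) (sym (null b))))
    where
    null : ∀ c → ν c * P H ≈ 0#
    null c = trans (*-congˡ (P-empty H (λ g h → a≰b (≡.subst₂ ℕ._≤_ (ℕ.+-identityʳ a) (ℕ.+-identityʳ b) (p g h)))))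
                   (zeroʳ (ν c))

  𝔼 : Weighted → Carrier
  𝔼 []            = 0#
  𝔼 ((n , E) ∷ L) = ν n * P E + 𝔼 L

  -- Turns a pointwise inequality of counts, in the applications a finite check on colours, into a
  -- linear inequality of probabilities.
  𝔼-mono : ∀ L M → (∀ g → count L g ℕ.≤ count M g) → 𝔼 L ≤ 𝔼 M
  𝔼-mono L M p = begin
    𝔼 L                                  ≈⟨ unconditional L ⟨
    ν 0 * P ⊤ᵗ + expectation ⊤ᵗ L        ≤⟨ expectation-mono ⊤ᵗ 0 0 L M (λ g _ → p g) ⟩
    ν 0 * P ⊤ᵗ + expectation ⊤ᵗ M        ≈⟨ unconditional M ⟩
    𝔼 M                                  ∎
    where
    expectation-⊤ : ∀ L → expectation ⊤ᵗ L ≈ 𝔼 L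
    expectation-⊤ []            = refl
    expectation-⊤ ((n , E) ∷ L) = +-cong (*-congˡ (P-cong (⊤ᵗ ∧ᵗ E) E (λ g → ≡.refl))) (expectation-⊤ L)

    unconditional : ∀ L → ν 0 * P ⊤ᵗ + expectation ⊤ᵗ L ≈ 𝔼 L
    unconditional L = trans (+-cong (zeroˡ (P ⊤ᵗ)) (expectation-⊤ L)) (+-identityˡ (𝔼 L))

Colour : Set
Colour = Fin 4

-- Orientation-preserving isometries of the complex plane

module Motions (em : ExcludedMiddle 0ℓ) (ℝ : CompleteOrderedField) where
  open CompleteOrderedField ℝ
  open Reals ℝ
  open OrderedField ℝ using (poset)
  open Complex commutativeRing
  open RingSolver complexRing
  open EuclideanPlane ℝ using (Isometry; dist)
  open PosetReasoning poset

  √1≈1 : √ 1# ≈ 1#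
  √1≈1 = antisym
    (square-cancel-≤ em 0≤1 (≤-reflexive (trans (√-square em 0≤1) (sym (*-identityˡ 1#)))))
    (square-cancel-≤ em (√-nonneg 1#) (≤-reflexive (trans (*-identityˡ 1#) (sym (√-square em 0≤1)))))

  dist≈1 : ∀ {A B} → N (A ℂ.- B) ≈ 1# → dist A B ≈ 1#
  dist≈1 unit = trans (√-cong unit) √1≈1

  -- Multiplication by `u` preserves distances because `N` is multiplicative, and its inverse is
  -- multiplication by `conj u`.
  motion : ∀ u t → N u ≈ 1# → Isometry
  motion u t unit = record
    { bijection = record
      { to        = to
      ; from      = from
      ; to-cong   = to-cong
      ; from-cong = from-cong
      ; inverse   = (λ {z} {w} w≈ → ℂ.trans (to-cong w≈) (to-from z))
                  , (λ {z} {w} w≈ → ℂ.trans (from-cong w≈) (from-to z))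
      }
    ; isometric = λ A B → √-cong (begin-equality
        N ((u ℂ.* A ℂ.+ t) ℂ.- (u ℂ.* B ℂ.+ t))
          ≈⟨ N-cong (solve 4 (λ u t A B → (u :* A :+ t) :- (u :* B :+ t) := u :* (A :- B)) ℂ.refl u t A B) ⟩
        N (u ℂ.* (A ℂ.- B))    ≈⟨ N-* u (A ℂ.- B) ⟩
        N u * N (A ℂ.- B)      ≈⟨ *-congʳ unit ⟩
        1# * N (A ℂ.- B)       ≈⟨ *-identityˡ _ ⟩
        N (A ℂ.- B)            ∎)
    }
    where
    to from : ℂ.Carrier → ℂ.Carrier
    to   z = u ℂ.* z ℂ.+ t
    from w = conj u ℂ.* (w ℂ.- t)

    to-cong : ∀ {z w} → z ℂ.≈ w → to z ℂ.≈ to w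
    to-cong z≈w = ℂ.+-congʳ (ℂ.*-congˡ {u} z≈w)

    from-cong : ∀ {z w} → z ℂ.≈ w → from z ℂ.≈ from w
    from-cong z≈w = ℂ.*-congˡ {conj u} (ℂ.+-congʳ z≈w)

    uū≈1 : u ℂ.* conj u ℂ.≈ ℂ.1#
    uū≈1 = ℂ.trans (*-conj u) (unit , refl)

    to-from : ∀ z → to (from z) ℂ.≈ z
    to-from z = ℂ.trans
      (solve 4 (λ u ū z t → u :* (ū :* (z :- t)) :+ t := u :* ū :* (z :- t) :+ t) ℂ.refl u (conj u) z t)
      (ℂ.trans (ℂ.+-congʳ (ℂ.*-congʳ {z ℂ.- t} uū≈1))
               (solve 2 (λ z t → κ 1 :* (z :- t) :+ t := z) ℂ.refl z t))

    from-to : ∀ z → from (to z) ℂ.≈ z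
    from-to z = ℂ.trans
      (solve 4 (λ u ū z t → ū :* (u :* z :+ t :- t) := u :* ū :* z) ℂ.refl u (conj u) z t)
      (ℂ.trans (ℂ.*-congʳ {z} uū≈1) (ℂ.*-identityˡ z))

-- Colour patterns and their finite combinatorics

sameᵇ : Colour → Colour → Bool
sameᵇ x y = ⌊ x ≟ y ⌋

-- Here `o` is the colour of the centre of a circle, `b` and `d` are those of the ends of a unit
-- chord, and `a` is that of another point on the circle.
apart : Colour → Colour → Colour → Colour → Bool
apart o a b d = sameᵇ o a ∧ not (sameᵇ o b) ∧ not (sameᵇ o d)

-- In an equilateral triangle, the vertex of colour `o` is the odd one out.
odd : Colour → Colour → Colour → Bool
odd o a b = sameᵇ a b ∧ not (sameᵇ o a)

[_]* : Bool → ℕ → ℕ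
[ b ]* n = if b then n else 0

-- The implicit argument is found by evaluating the decision procedure, so statements about finitely
-- many colours are proved by exhaustion.
decide : {A : Set} (a? : Dec A) {_ : True a?} → A
decide a? {t} = toWitness {a? = a?} t

module ColourCounts where
  open import Data.Nat.Base using (_+_; _≤_)

  exclusive : ∀ x y z → y ≢ z → [ sameᵇ x y ]* 1 + ([ sameᵇ x z ]* 1 + 0) ≤ 1
  exclusive = decide (all? λ x → all? λ y → all? λ z → ¬? (y ≟ z) →-dec (_ ℕ.≤? _))

  -- The four events are pairwise disjoint: the `apart` events by `a ≢ a′`, the coincidences by
  -- `b ≢ d`, and an `apart` event forbids both coincidences.
  exclusive₄ : ∀ o a a′ b d → a ≢ a′ → b ≢ d →
    [ apart o a b d ]* 1 + ([ apart o a′ d b ]* 1 + ([ sameᵇ o b ]* 1 + ([ sameᵇ o d ]* 1 + 0))) ≤ 1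
  exclusive₄ = decide (all? λ o → all? λ a → all? λ a′ → all? λ b → all? λ d →
    ¬? (a ≟ a′) →-dec ¬? (b ≟ d) →-dec (_ ℕ.≤? _))

  -- The common colour of `a` and `b` cannot be that of both `f` and `f′`, so it differs from one of
  -- them.
  odd-cover : ∀ o a b f f′ → f ≢ f′ →
    [ odd o a b ]* 1 + 0 ≤ [ apart a b o f ]* 1 + ([ apart b a o f′ ]* 1 + 0)
  odd-cover = decide (all? λ o → all? λ a → all? λ b → all? λ f → all? λ f′ →
    ¬? (f ≟ f′) →-dec (_ ℕ.≤? _))

  -- The weights give equality when all colours are o, and when none is o and
  -- exactly one pair agrees, which is not a pair of neighbours.
  hexagon : ∀ o x₀ x₁ x₂ x₃ →
    1 + ([ sameᵇ x₀ x₁ ]* 3 + ([ sameᵇ x₁ x₂ ]* 4 + ([ sameᵇ x₂ x₃ ]* 3 + 0))) ≤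
    [ sameᵇ x₀ x₂ ]* 1 + ([ sameᵇ x₁ x₃ ]* 1 + ([ sameᵇ x₀ x₃ ]* 1 +
    ([ odd o x₀ x₁ ]* 4 + ([ odd o x₁ x₂ ]* 5 + ([ odd o x₂ x₃ ]* 4 +
    ([ sameᵇ o x₀ ]* 1 + ([ sameᵇ o x₁ ]* 3 + ([ sameᵇ o x₂ ]* 3 + ([ sameᵇ o x₃ ]* 1 + 0)))))))))
  hexagon = decide (all? λ o → all? λ x₀ → all? λ x₁ → all? λ x₂ → all? λ x₃ → _ ℕ.≤? _)

  -- The vertices use three of the four colours. If neither `x` nor `y` repeats one of them, both
  -- are the fourth.
  triangle : ∀ a b c x y → a ≢ b → a ≢ c → b ≢ c →
    1 ≤ [ sameᵇ a x ]* 1 + ([ sameᵇ b x ]* 1 + ([ sameᵇ c x ]* 1 +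
        ([ sameᵇ a y ]* 1 + ([ sameᵇ b y ]* 1 + ([ sameᵇ c y ]* 1 + ([ sameᵇ x y ]* 1 + 0))))))
  triangle = decide (all? λ a → all? λ b → all? λ c → all? λ x → all? λ y →
    ¬? (a ≟ b) →-dec ¬? (a ≟ c) →-dec ¬? (b ≟ c) →-dec (_ ℕ.≤? _))

-- The random colouring and its invariance under isometries

module RandomColouring
  (em : ExcludedMiddle 0ℓ) (ℝ : CompleteOrderedField)
  (c₀ : EuclideanPlane.Colouring ℝ) (proper : EuclideanPlane.Proper ℝ c₀) (𝝁 : EuclideanPlane.InvariantMeasure ℝ)
  where
  open EuclideanPlane ℝ
  open CompleteOrderedField ℝ
  open Reals ℝ
  open OrderedField ℝ
  open Complex commutativeRing hiding (module ℂ)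
  open Complex commutativeRing using () renaming (module ℂ to K)
  open Motions em ℝ
  open DecidableEvents ℝ S₄×E₂ 𝝁 public
  open InvariantMeasure 𝝁
  private module G = Group S₄×E₂

  colour : G.Carrier → ℂ.Carrier → Colour
  colour g = Func.to (recolour c₀ g)

  colour-cong : ∀ g {A B} → A ℂ.≈ B → colour g A ≡ colour g B
  colour-cong g = Func.cong (recolour c₀ g)

  colour-congˡ : ∀ g h → g G.≈ h → ∀ A → colour g A ≡ colour h A
  colour-congˡ (σ , S) (τ , T) (σ≈τ , S≈T) A = ≡.trans
    (cong (Inverse.to σ) (Func.cong c₀ (Group.⁻¹-cong E₂ {S} {T} S≈T A)))
    (σ≈τ (Func.to c₀ (Isometry.from T A)))

  -- Every sample of the random colouring is proper, since `T` is an isometry and `σ` is injective.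
  unit⇒≢ : ∀ g {A B} → N (A K.- B) ≈ 1# → colour g A ≢ colour g B
  unit⇒≢ (σ , T) {A} {B} unit eq = proper (Isometry.from T A) (Isometry.from T B)
    (trans (Isometry.isometric (Group._⁻¹ E₂ T) A B) (dist≈1 unit))
    (≡.trans (≡.sym (Inverse.strictlyInverseʳ σ _))
      (≡.trans (cong (Inverse.from σ) eq) (Inverse.strictlyInverseʳ σ _)))

  _on_ : ∀ {n} → (Vec Colour n → Bool) → Vec ℂ.Carrier n → Test
  f on As = record
    { test      = λ g → f (map (colour g) As)
    ; test-cong = λ {g} {h} g≈h → cong f (map-cong (colour-congˡ g h g≈h) As)
    }

  -- Left-invariance for the element `(ε , F)`: after translating `h` by it, the image of a point
  -- under `F` has the colour that the point had under `h`.
  on-congruent : ∀ {n} (f : Vec Colour n → Bool) (F : Isometry) {As Bs : Vec ℂ.Carrier n} →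
                 Pointwise (λ A B → Isometry.to F A ℂ.≈ B) As Bs → P (f on As) ≈ P (f on Bs)
  on-congruent f F {As} {Bs} FA≈B = trans (sym (left-invariant g (event (f on As))))
    (μ-cong (g ⋆ event (f on As)) (event (f on Bs)) ((λ {k} → into {k}) , (λ {k} → out-of {k})))
    where
    g : G.Carrier
    g = Group.ε S₄ , F

    pull : ∀ h → map (colour (g G.∙ h)) Bs ≡ map (colour h) As
    pull h@(σ , S) = go FA≈B
      where
      go : ∀ {n} {As Bs : Vec ℂ.Carrier n} → Pointwise (λ A B → Isometry.to F A ℂ.≈ B) As Bs →
           map (colour (g G.∙ h)) Bs ≡ map (colour h) As
      go []             = ≡.refl
      go (FA≈B ∷ rest) = ≡.cong₂ _∷_
        (colour-cong h (Isometry.inverseʳ F (ℂ.sym FA≈B))) (go rest)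

    into : ∀ {k} → holds (g ⋆ event (f on As)) k → holds (event (f on Bs)) k
    into {k} (h , e , k≈gh) = subst T (≡.sym (≡.trans (test-cong (f on Bs) {k} {g G.∙ h} k≈gh) (cong f (pull h)))) e

    k≈g[g⁻¹k] : ∀ k → k G.≈ g G.∙ (g G.⁻¹ G.∙ k)
    k≈g[g⁻¹k] k = G.sym {g G.∙ (g G.⁻¹ G.∙ k)} {k}
      (G.trans {g G.∙ (g G.⁻¹ G.∙ k)} {g G.∙ g G.⁻¹ G.∙ k} {k}
        (G.sym {g G.∙ g G.⁻¹ G.∙ k} {g G.∙ (g G.⁻¹ G.∙ k)} (G.assoc g (g G.⁻¹) k))
        (G.trans {g G.∙ g G.⁻¹ G.∙ k} {G.ε G.∙ k} {k}
          (G.∙-cong {g G.∙ g G.⁻¹} {G.ε} {k} {k} (G.inverseʳ g) (G.refl {k})) (G.identityˡ k)))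

    out-of : ∀ {k} → holds (event (f on Bs)) k → holds (g ⋆ event (f on As)) k
    out-of {k} e = h , subst T (≡.trans (test-cong (f on Bs) {k} {g G.∙ h} (k≈g[g⁻¹k] k)) (cong f (pull h))) e , k≈g[g⁻¹k] k
      where
      h = g G.⁻¹ G.∙ k

  same : Vec Colour 2 → Bool
  same (x ∷ y ∷ []) = sameᵇ x y

  apartᵛ : Vec Colour 4 → Bool
  apartᵛ (o ∷ a ∷ b ∷ d ∷ []) = apart o a b d

  oddᵛ : Vec Colour 3 → Bool
  oddᵛ (o ∷ a ∷ b ∷ []) = odd o a b

  _∼_ : ℂ.Carrier → ℂ.Carrier → Test
  A ∼ B = same on (A ∷ B ∷ [])

  P-∼ : ∀ A B → P (A ∼ B) ≈ μ (monochromatic c₀ A B)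
  P-∼ A B = μ-cong (event (A ∼ B)) (monochromatic c₀ A B)
    ( (λ {g} → toWitness {a? = colour g A ≟ colour g B})
    , (λ {g} → fromWitness {a? = colour g A ≟ colour g B}))

-- Sixth roots of unity and rotations with a unit chord

module UnitVectors (em : ExcludedMiddle 0ℓ) (ℝ : CompleteOrderedField) where
  open CompleteOrderedField ℝ
  open Reals ℝ
  open OrderedField ℝ
  open RingSolver commutativeRing
  open Complex commutativeRing
  open PosetReasoning poset

  ½ : Carrier
  ½ = ν 2 ⁻¹

  2½≈1 : ν 2 * ½ ≈ 1#
  2½≈1 = ⁻¹-inverseʳ (ν-nonzero 1)

  √3 : Carrier
  √3 = √ # 3

  √3²≈3 : √3 * √3 ≈ ν 3
  √3²≈3 = trans (√-square em (#-nonneg 3)) (#≈ν 3)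

  -- e^(iπ/3)
  ω : ℂ.Carrier
  ω = ½ , ½ * √3

  -- e^(-iπ/3)
  ω̄ : ℂ.Carrier
  ω̄ = ℂ.1# ℂ.- ω

  N-ω : N ω ≈ 1#
  N-ω = modulo (½ * ½) √3²≈3 (modulo (ν 2 * ½ + 1#) 2½≈1
    (solve 2 (λ h s → (h :* h :+ (h :* s) :* (h :* s)) :=
      (κ 1 :+ h :* h :* (s :* s :- κ 3)) :+ (κ 2 :* h :+ κ 1) :* (κ 2 :* h :- κ 1)) refl ½ √3))

  -- The minimal polynomial of a primitive sixth root of unity, the relation that reduces powers of
  -- `ω` below.
  ω²≈ω-1 : ω ℂ.* ω ℂ.≈ ω ℂ.- ℂ.1#
  ω²≈ω-1 =
    modulo (- (½ * ½)) √3²≈3 (modulo (- (½ + 1#)) 2½≈1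
      (solve 2 (λ h s → h :* h :- (h :* s) :* (h :* s) :=
        ((h :- κ 1) :+ (:- (h :* h)) :* (s :* s :- κ 3)) :+ (:- (h :+ κ 1)) :* (κ 2 :* h :- κ 1)) refl ½ √3)) ,
    modulo (½ * √3) 2½≈1
      (solve 2 (λ h s → h :* (h :* s) :+ (h :* s) :* h :=
        (h :* s :- κ 0) :+ (h :* s) :* (κ 2 :* h :- κ 1)) refl ½ √3)

  N-1-ω : N (ℂ.1# ℂ.- ω) ≈ 1#
  N-1-ω = trans (modulo (- 1#) 2½≈1
    (solve 2 (λ h hs → (κ 1 :- h) :* (κ 1 :- h) :+ (κ 0 :- hs) :* (κ 0 :- hs) :=
      (h :* h :+ hs :* hs) :+ (:- κ 1) :* (κ 2 :* h :- κ 1)) refl ½ (½ * √3))) N-ω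

  -- A rotation whose chord on the circle of squared radius D has length 1.
  chord : ∀ D → 1# ≤ ν 4 * D → ∃ λ e → N e ≈ 1# × N (ℂ.1# ℂ.- e) * D ≈ 1#
  chord D 1≤4D = e , N-e , N-1-e
    where
    D+D≉0 : ¬ D + D ≈ 0#
    D+D≉0 = 1≤yx⇒x≉0 {y = ν 2} (≤-trans 1≤4D (≤-reflexive (solve 1 (λ d → κ 4 :* d := κ 2 :* (d :+ d)) refl D)))

    -- For rotation angle θ the squared chord is 2D(1 - cos θ). Setting it to 1 gives cos θ = 1 -
    -- 1/(2D), which is `C`.
    h = (D + D) ⁻¹
    C = 1# - h

    [D+D]h≈1 : (D + D) * h ≈ 1#
    [D+D]h≈1 = ⁻¹-inverseʳ D+D≉0

    0≤D+D : 0# ≤ D + D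
    0≤D+D with total 0# (D + D)
    ... | inj₁ p = p
    ... | inj₂ p = ⊥-elim (0≉1 (antisym 0≤1 (≤-trans 1≤4D 4D≤0)))
      where
      4D≤0 : ν 4 * D ≤ 0#
      4D≤0 = 0≤z≈y-x⇒x≤y (*-nonneg (ν-nonneg 2) (0≤-x p)) (solve 1 (λ d → κ 2 :* (:- (d :+ d)) := κ 0 :- κ 4 :* d) refl D)

    0≤h : 0# ≤ h
    0≤h = ⁻¹-nonneg em 0≤D+D D+D≉0

    -- This is cos θ ≥ -1, so that the squared sine is nonnegative and has a root.
    h≤2 : h ≤ ν 2
    h≤2 = 0≤z≈y-x⇒x≤y (*-nonneg 0≤h (x≤y⇒0≤y-x 1≤4D)) (modulo (ν 2) [D+D]h≈1
      (solve 2 (λ h d → h :* (κ 4 :* d :- κ 1) := (κ 2 :- h) :+ κ 2 :* ((d :+ d) :* h :- κ 1)) refl h D))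

    S² = 1# - C * C

    0≤S² : 0# ≤ S²
    0≤S² = ≤-trans (*-nonneg 0≤h (x≤y⇒0≤y-x h≤2)) (≤-reflexive
      (solve 1 (λ h → h :* (κ 2 :- h) := κ 1 :- (κ 1 :- h) :* (κ 1 :- h)) refl h))

    S = √ S²

    S*S≈ : S * S ≈ S²
    S*S≈ = √-square em 0≤S²

    e : ℂ.Carrier
    e = C , S

    N-e : N e ≈ 1#
    N-e = trans (+-congˡ S*S≈) (solve 1 (λ c → c :* c :+ (κ 1 :- c :* c) := κ 1) refl C)

    N-1-e : N (ℂ.1# ℂ.- e) * D ≈ 1#
    N-1-e = modulo D S*S≈ (modulo 1# [D+D]h≈1
      (solve 3 (λ h s d → ((κ 1 :- (κ 1 :- h)) :* (κ 1 :- (κ 1 :- h)) :+ (κ 0 :- s) :* (κ 0 :- s)) :* d :=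
        (κ 1 :+ d :* (s :* s :- (κ 1 :- (κ 1 :- h) :* (κ 1 :- h)))) :+ κ 1 :* ((d :+ d) :* h :- κ 1)) refl h S D))

-- Bounds on the probability of a coincidence

module Bounds
  (em : ExcludedMiddle 0ℓ) (ℝ : CompleteOrderedField)
  (c₀ : EuclideanPlane.Colouring ℝ) (proper : EuclideanPlane.Proper ℝ c₀) (𝝁 : EuclideanPlane.InvariantMeasure ℝ)
  where
  open EuclideanPlane ℝ
  open CompleteOrderedField ℝ
  open Reals ℝ
  open OrderedField ℝ
  open Complex commutativeRing hiding (module ℂ)
  open Complex commutativeRing using () renaming (module ℂ to K)
  open Motions em ℝ
  open UnitVectors em ℝ
  open RandomColouring em ℝ c₀ proper 𝝁
  open ColourCounts
  open PosetReasoning poset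
  open RingSolver commutativeRing
  open Mult semiring using (×-homo-+)
  private
    module KS = RingSolver complexRing

  -- The expectation with probabilities replaced by known values, which lets congruent pairs of
  -- points share one variable in `solve`.
  dot : Weighted → List Carrier → Carrier
  dot ((n , _) ∷ L) (x ∷ xs) = ν n * x + dot L xs
  dot _             _        = 0#

  Values : Weighted → List Carrier → Set
  Values = Listwise (λ (_ , E) x → P E ≈ x)

  𝔼≈dot : ∀ {L xs} → Values L xs → 𝔼 L ≈ dot L xs
  𝔼≈dot []       = refl
  𝔼≈dot (p ∷ ps) = +-cong (*-congˡ p) (𝔼≈dot ps)

  dot-mono : ∀ L M {xs ys} → Values L xs → Values M ys → (∀ g → count L g ℕ.≤ count M g) → dot L xs ≤ dot M ys
  dot-mono L M {xs} {ys} L≈ M≈ L≤M = begin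
    dot L xs  ≈⟨ 𝔼≈dot L≈ ⟨
    𝔼 L       ≤⟨ 𝔼-mono L M L≤M ⟩
    𝔼 M       ≈⟨ 𝔼≈dot M≈ ⟩
    dot M ys  ∎

  N-scale : ∀ {u z D} → N u ≈ 1# → N z ≈ D → N (u K.* z) ≈ D
  N-scale {u} {z} unit z≈D = trans (N-* u z) (trans (*-cong unit z≈D) (*-identityˡ _))

  -- The motion with linear part `u` = (A′ - B′)/(A - B) takes `A` to `A′` and `B` to `B′`. The
  -- quotient is written with the conjugate and `D ⁻¹`; it has modulus 1 because the distances
  -- agree.
  P-∼-cong : ∀ {A B A′ B′} → N (A K.- B) ≈ N (A′ K.- B′) → ¬ N (A K.- B) ≈ 0# → P (A ∼ B) ≈ P (A′ ∼ B′)
  P-∼-cong {A} {B} {A′} {B′} eq D≉0 = on-congruent same (motion u t N-u) (A↦A′ ∷ B↦B′ ∷ [])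
    where
    D = N (A K.- B)
    D⁻¹ : ℂ.Carrier
    D⁻¹ = D ⁻¹ , 0#
    u = (A′ K.- B′) K.* (conj (A K.- B) K.* D⁻¹)
    t = A′ K.- u K.* A

    N-u : N u ≈ 1#
    N-u = begin-equality
      N u                                          ≈⟨ N-* _ _ ⟩
      N (A′ K.- B′) * N (conj (A K.- B) K.* D⁻¹)   ≈⟨ *-cong (sym eq) (trans (N-* _ _) (*-congʳ (N-conj (A K.- B)))) ⟩
      D * (D * (D ⁻¹ * D ⁻¹ + 0# * 0#))            ≈⟨ solve 2 (λ d i → d :* (d :* (i :* i :+ κ 0 :* κ 0)) := (d :* i) :* (d :* i)) refl D (D ⁻¹) ⟩
      (D * D ⁻¹) * (D * D ⁻¹)                      ≈⟨ *-cong (⁻¹-inverseʳ D≉0) (⁻¹-inverseʳ D≉0) ⟩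
      1# * 1#                                      ≈⟨ *-identityˡ 1# ⟩
      1#                                           ∎

    quotient : (A K.- B) K.* conj (A K.- B) K.* D⁻¹ K.≈ K.1#
    quotient = K.trans (K.*-congʳ {D⁻¹} (*-conj (A K.- B)))
      ( trans (solve 2 (λ d i → d :* i :- κ 0 :* κ 0 := d :* i) refl D (D ⁻¹)) (⁻¹-inverseʳ D≉0)
      , solve 2 (λ d i → d :* κ 0 :+ κ 0 :* i := κ 0) refl D (D ⁻¹))

    A↦A′ : u K.* A K.+ t K.≈ A′
    A↦A′ = KS.solve 2 (λ uA A′ → uA KS.:+ (A′ KS.:- uA) KS.:= A′) K.refl (u K.* A) A′

    B↦B′ : u K.* B K.+ t K.≈ B′
    B↦B′ = KS.modulo (K.- (A′ K.- B′)) quotient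
      (KS.solve 6 (λ A B A′ B′ c i →
        (A′ KS.:- B′) KS.:* (c KS.:* i) KS.:* B KS.:+ (A′ KS.:- (A′ KS.:- B′) KS.:* (c KS.:* i) KS.:* A) KS.:=
        B′ KS.:+ (KS.:- (A′ KS.:- B′)) KS.:* ((A KS.:- B) KS.:* c KS.:* i KS.:- KS.κ 1))
        K.refl A B A′ B′ (conj (A K.- B)) D⁻¹)

  -- The probability that two points at squared distance D get the same colour.
  prob : Carrier → Carrier
  prob D = P (K.0# ∼ (√ D , 0#))

  P-∼≈prob : ∀ {A B D} → 1# ≤ ν 4 * D → N (A K.- B) ≈ D → P (A ∼ B) ≈ prob D
  P-∼≈prob {A} {B} {D} 1≤4D N≈D = P-∼-cong
    (trans N≈D (sym (trans
      (solve 1 (λ s → (κ 0 :- s) :* (κ 0 :- s) :+ (κ 0 :- κ 0) :* (κ 0 :- κ 0) := s :* s) refl (√ D))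
      (√-square em (1≤4x⇒0≤x 1≤4D)))))
    (λ N≈0 → 1≤yx⇒x≉0 {y = ν 4} 1≤4D (trans (sym N≈D) N≈0))

  0-z : ∀ {z D} → N z ≈ D → N (K.0# K.- z) ≈ D
  0-z {z} N≈D = trans (trans (N-cong (KS.solve 1 (λ z → KS.κ 0 KS.:- z KS.:= KS.:- z) K.refl z)) (N-neg z)) N≈D

  -- Unit chords of a circle and equilateral triangles with an odd vertex

  module _ {D} (1≤4D : 1# ≤ ν 4 * D) where

    private
      p = prob D

    at-D : ∀ {A B} → N (A K.- B) ≈ D → P (A ∼ B) ≈ p
    at-D = P-∼≈prob 1≤4D

    module _ {z} (Nz : N z ≈ D) {e} (N-e : N e ≈ 1#) (N-1-e : N (K.1# K.- e) * D ≈ 1#) where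

      unit-chord : N (z K.- e K.* z) ≈ 1#
      unit-chord = trans (N-cong (KS.solve 2 (λ e z → z KS.:- e KS.:* z KS.:= (KS.κ 1 KS.:- e) KS.:* z) K.refl e z))
        (trans (N-* _ z) (trans (*-congˡ Nz) N-1-e))

      unit-chord-rotated : ∀ {ρ} → N ρ ≈ 1# → N (ρ K.* z K.- e K.* (ρ K.* z)) ≈ 1#
      unit-chord-rotated {ρ} N-ρ = trans
        (N-cong (KS.solve 3 (λ ρ e z → ρ KS.:* z KS.:- e KS.:* (ρ KS.:* z) KS.:= ρ KS.:* (z KS.:- e KS.:* z)) K.refl ρ e z))
        (N-scale N-ρ unit-chord)

      -- The ends `z` and `ez` of a unit chord cannot both have the colour of the centre 0.
      chord⇒2*prob≤1 : ν 2 * p ≤ 1#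
      chord⇒2*prob≤1 = begin
        ν 2 * p
          ≈⟨ solve 1 (λ p → κ 2 :* p := κ 1 :* p :+ (κ 1 :* p :+ κ 0)) refl p ⟩
        ν 1 * p + (ν 1 * p + 0#)
          ≤⟨ dot-mono ((1 , K.0# ∼ z) ∷ (1 , K.0# ∼ (e K.* z)) ∷ []) ((1 , ⊤ᵗ) ∷ [])
               (at-D (0-z Nz) ∷ at-D (0-z (N-scale N-e Nz)) ∷ []) (P-⊤ ∷ [])
               (λ g → exclusive (colour g K.0#) (colour g z) (colour g (e K.* z)) (unit⇒≢ g unit-chord)) ⟩
        ν 1 * 1# + 0#
          ≈⟨ solve 0 (κ 1 :* κ 1 :+ κ 0 := κ 1) refl ⟩
        1#
          ∎

      -- Rotation by `e` takes 0, ρz, z, ēz to 0, eρz, ez, z. The second event thus becomes the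
      -- mirror pattern in `exclusive₄`, whose unit pairs are z, ez and ρz, eρz.
      apart-≤ : ∀ {ρ} → N ρ ≈ 1# →
        P (apartᵛ on (K.0# ∷ ρ K.* z ∷ z ∷ e K.* z ∷ [])) +
        P (apartᵛ on (K.0# ∷ ρ K.* z ∷ z ∷ conj e K.* z ∷ [])) + ν 2 * p ≤ 1#
      apart-≤ {ρ} N-ρ = begin
        P E + P E′ + ν 2 * p
          ≈⟨ solve 3 (λ x y p → x :+ y :+ κ 2 :* p := κ 1 :* x :+ (κ 1 :* y :+ (κ 1 :* p :+ (κ 1 :* p :+ κ 0)))) refl (P E) (P E′) p ⟩
        ν 1 * P E + (ν 1 * P E′ + (ν 1 * p + (ν 1 * p + 0#)))
          ≤⟨ dot-mono ((1 , E) ∷ (1 , E″) ∷ (1 , K.0# ∼ z) ∷ (1 , K.0# ∼ (e K.* z)) ∷ []) ((1 , ⊤ᵗ) ∷ [])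
               (refl ∷ sym E′≈E″ ∷ at-D (0-z Nz) ∷ at-D (0-z (N-scale N-e Nz)) ∷ []) (P-⊤ ∷ [])
               (λ g → exclusive₄ (colour g K.0#) (colour g (ρ K.* z)) (colour g (e K.* (ρ K.* z))) (colour g z) (colour g (e K.* z))
                        (unit⇒≢ g (unit-chord-rotated N-ρ)) (unit⇒≢ g unit-chord)) ⟩
        ν 1 * 1# + 0#
          ≈⟨ solve 0 (κ 1 :* κ 1 :+ κ 0 := κ 1) refl ⟩
        1#
          ∎
        where
        E  = apartᵛ on (K.0# ∷ ρ K.* z ∷ z ∷ e K.* z ∷ [])
        E′ = apartᵛ on (K.0# ∷ ρ K.* z ∷ z ∷ conj e K.* z ∷ [])
        E″ = apartᵛ on (K.0# ∷ e K.* (ρ K.* z) ∷ e K.* z ∷ z ∷ [])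

        eē≈1 : e K.* conj e K.≈ K.1#
        eē≈1 = K.trans (*-conj e) (N-e , refl)

        E′≈E″ : P E′ ≈ P E″
        E′≈E″ = on-congruent apartᵛ (motion e K.0# N-e)
          ( KS.solve 1 (λ e → e KS.:* KS.κ 0 KS.:+ KS.κ 0 KS.:= KS.κ 0) K.refl e
          ∷ K.+-identityʳ _ ∷ K.+-identityʳ _
          ∷ KS.modulo z eē≈1 (KS.solve 3 (λ e ē z → e KS.:* (ē KS.:* z) KS.:+ KS.κ 0 KS.:= z KS.:+ z KS.:* (e KS.:* ē KS.:- KS.κ 1)) K.refl e (conj e) z)
          ∷ [])

      -- Rotating 0 about `z` and about `ωz` by `e` gives points `f` and `f′` at distance 1. By
      -- `odd-cover` the common colour of `z` and `ωz` misses one of them; a motion then brings that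
      -- case to an `apart` event centred at 0.
      odd-≤ : P (oddᵛ on (K.0# ∷ z ∷ ω K.* z ∷ [])) ≤
              P (apartᵛ on (K.0# ∷ ω̄ K.* z ∷ z ∷ e K.* z ∷ [])) +
              P (apartᵛ on (K.0# ∷ ω K.* z ∷ z ∷ e K.* z ∷ []))
      odd-≤ = begin
        P O
          ≈⟨ solve 1 (λ x → x := κ 1 :* x :+ κ 0) refl (P O) ⟩
        ν 1 * P O + 0#
          ≤⟨ dot-mono ((1 , O) ∷ []) ((1 , E) ∷ (1 , F) ∷ []) (refl ∷ []) (E≈ ∷ F≈ ∷ [])
               (λ g → odd-cover (colour g K.0#) (colour g z) (colour g (ω K.* z)) (colour g f) (colour g f′) (unit⇒≢ g f-f′)) ⟩
        ν 1 * P E′ + (ν 1 * P F′ + 0#)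
          ≈⟨ solve 2 (λ x y → κ 1 :* x :+ (κ 1 :* y :+ κ 0) := x :+ y) refl (P E′) (P F′) ⟩
        P E′ + P F′
          ∎
        where
        f f′ : ℂ.Carrier
        f  = (K.1# K.- e) K.* z
        f′ = (K.1# K.- e) K.* (ω K.* z)
        O  = oddᵛ on (K.0# ∷ z ∷ ω K.* z ∷ [])
        E  = apartᵛ on (z ∷ ω K.* z ∷ K.0# ∷ f ∷ [])
        F  = apartᵛ on (ω K.* z ∷ z ∷ K.0# ∷ f′ ∷ [])
        E′ = apartᵛ on (K.0# ∷ ω̄ K.* z ∷ z ∷ e K.* z ∷ [])
        F′ = apartᵛ on (K.0# ∷ ω K.* z ∷ z ∷ e K.* z ∷ [])

        f-f′ : N (f K.- f′) ≈ 1#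
        f-f′ = trans
          (N-cong (KS.solve 3 (λ e w z → (KS.κ 1 KS.:- e) KS.:* z KS.:- (KS.κ 1 KS.:- e) KS.:* (w KS.:* z) KS.:=
                                         (KS.κ 1 KS.:- w) KS.:* (z KS.:- e KS.:* z)) K.refl e ω z))
          (N-scale N-1-ω unit-chord)

        E≈ : P E ≈ P E′
        -- The half-turn w ↦ z - w exchanges 0 and `z`.
        E≈ = on-congruent apartᵛ (motion (K.- K.1#) z (trans (N-neg K.1#) N-1))
          ( KS.solve 1 (λ z → (KS.:- KS.κ 1) KS.:* z KS.:+ z KS.:= KS.κ 0) K.refl z
          ∷ KS.solve 2 (λ w z → (KS.:- KS.κ 1) KS.:* (w KS.:* z) KS.:+ z KS.:= (KS.κ 1 KS.:- w) KS.:* z) K.refl ω z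
          ∷ KS.solve 1 (λ z → (KS.:- KS.κ 1) KS.:* KS.κ 0 KS.:+ z KS.:= z) K.refl z
          ∷ KS.solve 2 (λ e z → (KS.:- KS.κ 1) KS.:* ((KS.κ 1 KS.:- e) KS.:* z) KS.:+ z KS.:= e KS.:* z) K.refl e z
          ∷ [])
          where
          N-1 : N K.1# ≈ 1#
          N-1 = solve 0 (κ 1 :* κ 1 :+ κ 0 :* κ 0 := κ 1) refl

        F≈ : P F ≈ P F′
        -- Since -ω̄ = ω², this is the rotation by 120° permuting the triangle as ωz ↦ 0 ↦ z ↦ ωz.
        F≈ = on-congruent apartᵛ (motion (K.- ω̄) z (trans (N-neg ω̄) N-1-ω))
          ( KS.modulo z ω²≈ω-1 (KS.solve 2 (λ w z → (KS.:- (KS.κ 1 KS.:- w)) KS.:* (w KS.:* z) KS.:+ z KS.:=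
              KS.κ 0 KS.:+ z KS.:* (w KS.:* w KS.:- (w KS.:- KS.κ 1))) K.refl ω z)
          ∷ KS.solve 2 (λ w z → (KS.:- (KS.κ 1 KS.:- w)) KS.:* z KS.:+ z KS.:= w KS.:* z) K.refl ω z
          ∷ KS.solve 2 (λ w z → (KS.:- (KS.κ 1 KS.:- w)) KS.:* KS.κ 0 KS.:+ z KS.:= z) K.refl ω z
          ∷ KS.modulo ((K.1# K.- e) K.* z) ω²≈ω-1 (KS.solve 3 (λ e w z →
              (KS.:- (KS.κ 1 KS.:- w)) KS.:* ((KS.κ 1 KS.:- e) KS.:* (w KS.:* z)) KS.:+ z KS.:=
              e KS.:* z KS.:+ ((KS.κ 1 KS.:- e) KS.:* z) KS.:* (w KS.:* w KS.:- (w KS.:- KS.κ 1))) K.refl e ω z)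
          ∷ [])

    -- Both `e` and `conj e` have a unit chord. Adding `odd-≤` for the two gives four `apart`
    -- events, which pair up into `apart-≤` for ρ = ω̄ and for ρ = ω; this is twice the claim.
    odd-rare : ∀ {z} → N z ≈ D → P (oddᵛ on (K.0# ∷ z ∷ ω K.* z ∷ [])) + ν 2 * p ≤ 1#
    odd-rare {z} Nz = *-cancelʳ-≤ em (ν-nonneg 2) (ν-nonzero 1) (begin
      (π + ν 2 * p) * ν 2
        ≈⟨ solve 2 (λ π p → (π :+ κ 2 :* p) :* κ 2 := (π :+ π) :+ (κ 2 :* p :+ κ 2 :* p)) refl π p ⟩
      (π + π) + (ν 2 * p + ν 2 * p)
        ≤⟨ +-monoˡ-≤ _ (+-mono-≤ (odd-≤ Nz N-e N-1-e) (odd-≤ Nz N-ē N-1-ē)) ⟩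
      ((A + B) + (A′ + B′)) + (ν 2 * p + ν 2 * p)
        ≈⟨ solve 5 (λ a b c d p → ((a :+ b) :+ (c :+ d)) :+ (κ 2 :* p :+ κ 2 :* p) :=
             (a :+ c :+ κ 2 :* p) :+ (b :+ d :+ κ 2 :* p)) refl A B A′ B′ p ⟩
      (A + A′ + ν 2 * p) + (B + B′ + ν 2 * p)
        ≤⟨ +-mono-≤ (apart-≤ Nz N-e N-1-e N-1-ω) (apart-≤ Nz N-e N-1-e N-ω) ⟩
      1# + 1#
        ≈⟨ solve 0 (κ 1 :+ κ 1 := κ 1 :* κ 2) refl ⟩
      1# * ν 2
        ∎)
      where
      e = proj₁ (chord D 1≤4D)
      N-e = proj₁ (proj₂ (chord D 1≤4D))
      N-1-e = proj₂ (proj₂ (chord D 1≤4D))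
      N-ē : N (conj e) ≈ 1#
      N-ē = trans (N-conj e) N-e
      N-1-ē : N (K.1# K.- conj e) * D ≈ 1#
      N-1-ē = trans (*-congʳ (solve 2 (λ a b → (κ 1 :- a) :* (κ 1 :- a) :+ (κ 0 :- (:- b)) :* (κ 0 :- (:- b)) :=
        (κ 1 :- a) :* (κ 1 :- a) :+ (κ 0 :- b) :* (κ 0 :- b)) refl (proj₁ e) (proj₂ e))) N-1-e

      π  = P (oddᵛ on (K.0# ∷ z ∷ ω K.* z ∷ []))
      A  = P (apartᵛ on (K.0# ∷ ω̄ K.* z ∷ z ∷ e K.* z ∷ []))
      B  = P (apartᵛ on (K.0# ∷ ω K.* z ∷ z ∷ e K.* z ∷ []))
      A′ = P (apartᵛ on (K.0# ∷ ω̄ K.* z ∷ z ∷ conj e K.* z ∷ []))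
      B′ = P (apartᵛ on (K.0# ∷ ω K.* z ∷ z ∷ conj e K.* z ∷ []))

  2*prob≤1 : ∀ {D} → 1# ≤ ν 4 * D → ν 2 * prob D ≤ 1#
  2*prob≤1 {D} 1≤4D = chord⇒2*prob≤1 1≤4D Nz (proj₁ (proj₂ (chord D 1≤4D))) (proj₂ (proj₂ (chord D 1≤4D)))
    where
    Nz : N (√ D , 0#) ≈ D
    Nz = trans (solve 1 (λ s → s :* s :+ κ 0 :* κ 0 := s :* s) refl (√ D)) (√-square em (1≤4x⇒0≤x 1≤4D))

  -- The half hexagon and the bound 27/56

  multiple : ∀ {D} n → 1# ≤ ν 4 * D → 1# ≤ ν 4 * (ν (ℕ.suc n) * D)
  multiple {D} n 1≤4D = begin
    1#                       ≤⟨ 1≤4D ⟩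
    ν 4 * D                  ≤⟨ x≤y+x (*-nonneg (ν-nonneg n) (*-nonneg (ν-nonneg 4) (1≤4x⇒0≤x 1≤4D))) ⟩
    ν n * (ν 4 * D) + ν 4 * D
      ≈⟨ solve 2 (λ n d → n :* (κ 4 :* d) :+ κ 4 :* d := κ 4 :* ((κ 1 :+ n) :* d)) refl (ν n) D ⟩
    ν 4 * ((1# + ν n) * D)   ≈⟨ *-congˡ (*-congʳ (×-homo-+ 1# 1 n)) ⟨
    ν 4 * (ν (ℕ.suc n) * D)  ∎

  -- With a, b the probabilities at squared distances 3D, 4D and wᵢ those of `Wᵢ`, the count
  -- `hexagon` gives 1 + 10p ≤ 2a + b + 4w₀ + 5w₁ + 4w₂ + 8p. Inserting a, b ≤ 1/2 and wᵢ ≤ 1 - 2p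
  -- leaves 28p ≤ 27/2.
  56*prob≤27 : ∀ {D} → 1# ≤ ν 4 * D → ν 56 * prob D ≤ ν 27
  56*prob≤27 {D} 1≤4D = 0≤z≈y-x⇒x≤y
    (+-nonneg (*-nonneg (ν-nonneg 2) (x≤y⇒0≤y-x main))
    (+-nonneg (*-nonneg (ν-nonneg 2) (x≤y⇒0≤y-x (2*prob≤1 1≤4·3D)))
    (+-nonneg (x≤y⇒0≤y-x (2*prob≤1 1≤4·4D))
    (+-nonneg (*-nonneg (ν-nonneg 8) (x≤y⇒0≤y-x (odd-rare 1≤4D N₀)))
    (+-nonneg (*-nonneg (ν-nonneg 10) (x≤y⇒0≤y-x (odd-rare 1≤4D N₁)))
              (*-nonneg (ν-nonneg 8) (x≤y⇒0≤y-x (odd-rare 1≤4D N₂))))))))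
    (solve 6 (λ p a b w₀ w₁ w₂ →
      κ 2 :* ((κ 1 :* a :+ (κ 1 :* a :+ (κ 1 :* b :+ (κ 4 :* w₀ :+ (κ 5 :* w₁ :+ (κ 4 :* w₂ :+
              (κ 1 :* p :+ (κ 3 :* p :+ (κ 3 :* p :+ (κ 1 :* p :+ κ 0))))))))))
            :- (κ 1 :* κ 1 :+ (κ 3 :* p :+ (κ 4 :* p :+ (κ 3 :* p :+ κ 0))))) :+
      (κ 2 :* (κ 1 :- κ 2 :* a) :+
      ((κ 1 :- κ 2 :* b) :+
      (κ 8 :* (κ 1 :- (w₀ :+ κ 2 :* p)) :+
      (κ 10 :* (κ 1 :- (w₁ :+ κ 2 :* p)) :+
      κ 8 :* (κ 1 :- (w₂ :+ κ 2 :* p)))))) :=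
      κ 27 :- κ 56 :* p) refl (prob D) (prob (ν 3 * D)) (prob (ν 4 * D)) (P W₀) (P W₁) (P W₂))
    where
    1≤4·3D = multiple {D} 2 1≤4D
    1≤4·4D = multiple {D} 3 1≤4D

    z₀ z₁ z₂ z₃ : ℂ.Carrier
    z₀ = √ D , 0#
    z₁ = ω K.* z₀
    z₂ = ω K.* z₁
    z₃ = ω K.* z₂

    N₀ : N z₀ ≈ D
    N₀ = trans (solve 1 (λ s → s :* s :+ κ 0 :* κ 0 := s :* s) refl (√ D)) (√-square em (1≤4x⇒0≤x 1≤4D))
    N₁ : N z₁ ≈ D
    N₁ = N-scale N-ω N₀
    N₂ : N z₂ ≈ D
    N₂ = N-scale N-ω N₁
    N₃ : N z₃ ≈ D
    N₃ = N-scale N-ω N₂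

    side : ∀ {z} → N z ≈ D → N (z K.- ω K.* z) ≈ D
    side {z} Nz = trans (N-cong (KS.solve 2 (λ w z → z KS.:- w KS.:* z KS.:= (KS.κ 1 KS.:- w) KS.:* z) K.refl ω z))
      (N-scale N-1-ω Nz)

    N-1-ω² : N (K.1# K.- ω K.* ω) ≈ ν 3
    N-1-ω² = begin-equality
      N (K.1# K.- ω K.* ω)          ≈⟨ N-cong (K.+-congˡ (K.-‿cong ω²≈ω-1)) ⟩
      N (K.1# K.- (ω K.- K.1#))     ≈⟨ modulo (- ν 2) 2½≈1 (solve 2 (λ h k →
        (κ 1 :- (h :- κ 1)) :* (κ 1 :- (h :- κ 1)) :+ (κ 0 :- (k :- κ 0)) :* (κ 0 :- (k :- κ 0)) :=
        (κ 2 :+ (h :* h :+ k :* k)) :+ (:- κ 2) :* (κ 2 :* h :- κ 1)) refl ½ (½ * √3)) ⟩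
      ν 2 + N ω                     ≈⟨ +-congˡ N-ω ⟩
      ν 3                           ∎

    diagonal : ∀ {z} → N z ≈ D → N (z K.- ω K.* (ω K.* z)) ≈ ν 3 * D
    diagonal {z} Nz = trans
      (N-cong (KS.solve 2 (λ w z → z KS.:- w KS.:* (w KS.:* z) KS.:= (KS.κ 1 KS.:- w KS.:* w) KS.:* z) K.refl ω z))
      (trans (N-* _ z) (*-cong N-1-ω² Nz))

    ω³z≈-z : ∀ z → ω K.* (ω K.* (ω K.* z)) K.≈ K.- z
    ω³z≈-z z = KS.modulo ((ω K.+ K.1#) K.* z) ω²≈ω-1 (KS.solve 2 (λ w z →
      w KS.:* (w KS.:* (w KS.:* z)) KS.:=
      KS.:- z KS.:+ ((w KS.:+ KS.κ 1) KS.:* z) KS.:* (w KS.:* w KS.:- (w KS.:- KS.κ 1))) K.refl ω z)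

    antipodal : N (z₀ K.- z₃) ≈ ν 4 * D
    antipodal = trans (N-cong (K.+-congˡ (K.-‿cong (ω³z≈-z z₀)))) (trans
      (solve 2 (λ a b → (a :- (:- a)) :* (a :- (:- a)) :+ (b :- (:- b)) :* (b :- (:- b)) := κ 4 :* (a :* a :+ b :* b))
        refl (√ D) 0#)
      (*-congˡ N₀))

    W₀ W₁ W₂ : Test
    W₀ = oddᵛ on (K.0# ∷ z₀ ∷ z₁ ∷ [])
    W₁ = oddᵛ on (K.0# ∷ z₁ ∷ z₂ ∷ [])
    W₂ = oddᵛ on (K.0# ∷ z₂ ∷ z₃ ∷ [])

    main : _ ≤ _
    main = dot-mono
      ((1 , ⊤ᵗ) ∷ (3 , z₀ ∼ z₁) ∷ (4 , z₁ ∼ z₂) ∷ (3 , z₂ ∼ z₃) ∷ [])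
      ((1 , z₀ ∼ z₂) ∷ (1 , z₁ ∼ z₃) ∷ (1 , z₀ ∼ z₃) ∷ (4 , W₀) ∷ (5 , W₁) ∷ (4 , W₂) ∷
       (1 , K.0# ∼ z₀) ∷ (3 , K.0# ∼ z₁) ∷ (3 , K.0# ∼ z₂) ∷ (1 , K.0# ∼ z₃) ∷ [])
      (P-⊤ ∷ at-D 1≤4D (side N₀) ∷ at-D 1≤4D (side N₁) ∷ at-D 1≤4D (side N₂) ∷ [])
      (at-D 1≤4·3D (diagonal N₀) ∷ at-D 1≤4·3D (diagonal N₁) ∷ at-D 1≤4·4D antipodal ∷ refl ∷ refl ∷ refl ∷
       at-D 1≤4D (0-z N₀) ∷ at-D 1≤4D (0-z N₁) ∷ at-D 1≤4D (0-z N₂) ∷ at-D 1≤4D (0-z N₃) ∷ [])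
      (λ g → hexagon (colour g K.0#) (colour g z₀) (colour g z₁) (colour g z₂) (colour g z₃))

  -- The unit triangle with two further points

  -- X lies on the axis of the triangle 0, 1, ω through 0, and Y on the axis through 1.
  140*prob≥1 : ∀ {D} r → 1# ≤ ν 4 * D → 1# ≤ ν 4 * (r * r) → 1# ≤ ν 4 * ((√3 - r) * (√3 - r)) →
                 r * r - √3 * r + 1# ≈ D → ν 1 ≤ ν 140 * prob D
  -- From 1 ≤ 5p + q + q′ and 56q, 56q′ ≤ 27 follows 2 ≤ 280p.
  140*prob≥1 {D} r 1≤4D 1≤4q 1≤4q′ r²-√3r+1≈D = *-cancelʳ-≤ em (ν-nonneg 2) (ν-nonzero 1) (0≤z≈y-x⇒x≤y
    (+-nonneg (*-nonneg (ν-nonneg 56) (x≤y⇒0≤y-x main))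
    (+-nonneg (x≤y⇒0≤y-x (56*prob≤27 1≤4q)) (x≤y⇒0≤y-x (56*prob≤27 1≤4q′))))
    (solve 3 (λ p q q′ →
      κ 56 :* ((κ 1 :* q :+ (κ 1 :* p :+ (κ 1 :* p :+ (κ 1 :* p :+ (κ 1 :* q′ :+ (κ 1 :* p :+ (κ 1 :* p :+ κ 0)))))))
               :- (κ 1 :* κ 1 :+ κ 0)) :+
      ((κ 27 :- κ 56 :* q) :+ (κ 27 :- κ 56 :* q′)) :=
      κ 140 :* p :* κ 2 :- κ 1 :* κ 2) refl (prob D) (prob (r * r)) (prob ((√3 - r) * (√3 - r)))))
    where
    X Y : ℂ.Carrier
    -- `X` is r e^(iπ/6), and `Y` is 1 + (√3 - r) e^(5iπ/6) simplified by √3² = 3.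
    X = ½ * (√3 * r) , ½ * r
    Y = ½ * (√3 * r - 1#) , ½ * (√3 - r)

    main : _ ≤ _
    main = dot-mono ((1 , ⊤ᵗ) ∷ [])
      ((1 , K.0# ∼ X) ∷ (1 , K.1# ∼ X) ∷ (1 , ω ∼ X) ∷ (1 , K.0# ∼ Y) ∷ (1 , K.1# ∼ Y) ∷ (1 , ω ∼ Y) ∷ (1 , X ∼ Y) ∷ [])
      (P-⊤ ∷ [])
      (at-D 1≤4q 0-X ∷ at-D 1≤4D 1-X ∷ at-D 1≤4D ω-X ∷ at-D 1≤4D 0-Y ∷ at-D 1≤4q′ 1-Y ∷ at-D 1≤4D ω-Y ∷ at-D 1≤4D X-Y ∷ [])
      (λ g → triangle (colour g K.0#) (colour g K.1#) (colour g ω) (colour g X) (colour g Y)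
               (unit⇒≢ g 0-1) (unit⇒≢ g (0-z N-ω)) (unit⇒≢ g N-1-ω))
      where
      0-1 : N (K.0# K.- K.1#) ≈ 1#
      0-1 = solve 0 ((κ 0 :- κ 1) :* (κ 0 :- κ 1) :+ (κ 0 :- κ 0) :* (κ 0 :- κ 0) := κ 1) refl

      by-√3-and-½ : ∀ {x y} k l → x ≈ (y + k * (√3 * √3 - ν 3)) + l * (ν 2 * ½ - 1#) → x ≈ y
      by-√3-and-½ k l eq = modulo k √3²≈3 (modulo l 2½≈1 eq)

      0-X : N (K.0# K.- X) ≈ r * r
      0-X = by-√3-and-½ (½ * ½ * (r * r)) (r * r * (ν 2 * ½ + 1#)) (solve 3 (λ h s r →
        (κ 0 :- h :* (s :* r)) :* (κ 0 :- h :* (s :* r)) :+ (κ 0 :- h :* r) :* (κ 0 :- h :* r) :=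
        (r :* r :+ (h :* h :* (r :* r)) :* (s :* s :- κ 3)) :+
        (r :* r :* (κ 2 :* h :+ κ 1)) :* (κ 2 :* h :- κ 1)) refl ½ √3 r)
      1-X : N (K.1# K.- X) ≈ D
      1-X = trans (by-√3-and-½ (½ * ½ * (r * r)) (r * r * (ν 2 * ½ + 1#) - √3 * r) (solve 3 (λ h s r →
        (κ 1 :- h :* (s :* r)) :* (κ 1 :- h :* (s :* r)) :+ (κ 0 :- h :* r) :* (κ 0 :- h :* r) :=
        ((r :* r :- s :* r :+ κ 1) :+ (h :* h :* (r :* r)) :* (s :* s :- κ 3)) :+
        (r :* r :* (κ 2 :* h :+ κ 1) :- s :* r) :* (κ 2 :* h :- κ 1)) refl ½ √3 r)) r²-√3r+1≈D
      ω-X : N (ω K.- X) ≈ D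
      ω-X = trans (by-√3-and-½ (½ * ½ * (1# + r * r)) ((ν 2 * ½ + 1#) * (r * r - √3 * r + 1#)) (solve 3 (λ h s r →
        (h :- h :* (s :* r)) :* (h :- h :* (s :* r)) :+ (h :* s :- h :* r) :* (h :* s :- h :* r) :=
        ((r :* r :- s :* r :+ κ 1) :+ (h :* h :* (κ 1 :+ r :* r)) :* (s :* s :- κ 3)) :+
        ((κ 2 :* h :+ κ 1) :* (r :* r :- s :* r :+ κ 1)) :* (κ 2 :* h :- κ 1)) refl ½ √3 r)) r²-√3r+1≈D
      0-Y : N (K.0# K.- Y) ≈ D
      0-Y = trans (by-√3-and-½ (½ * ½ * (1# + r * r)) ((ν 2 * ½ + 1#) * (r * r - √3 * r + 1#)) (solve 3 (λ h s r →
        (κ 0 :- h :* (s :* r :- κ 1)) :* (κ 0 :- h :* (s :* r :- κ 1)) :+ (κ 0 :- h :* (s :- r)) :* (κ 0 :- h :* (s :- r)) :=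
        ((r :* r :- s :* r :+ κ 1) :+ (h :* h :* (κ 1 :+ r :* r)) :* (s :* s :- κ 3)) :+
        ((κ 2 :* h :+ κ 1) :* (r :* r :- s :* r :+ κ 1)) :* (κ 2 :* h :- κ 1)) refl ½ √3 r)) r²-√3r+1≈D
      1-Y : N (K.1# K.- Y) ≈ (√3 - r) * (√3 - r)
      1-Y = by-√3-and-½ (½ * ½ * (1# + r * r) - 1#) ((ν 2 * ½ + 1#) * (r * r - √3 * r + 1#) - (√3 * r - 1#))
        (solve 3 (λ h s r →
        (κ 1 :- h :* (s :* r :- κ 1)) :* (κ 1 :- h :* (s :* r :- κ 1)) :+ (κ 0 :- h :* (s :- r)) :* (κ 0 :- h :* (s :- r)) :=
        ((s :- r) :* (s :- r) :+ (h :* h :* (κ 1 :+ r :* r) :- κ 1) :* (s :* s :- κ 3)) :+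
        ((κ 2 :* h :+ κ 1) :* (r :* r :- s :* r :+ κ 1) :- (s :* r :- κ 1)) :* (κ 2 :* h :- κ 1)) refl ½ √3 r)
      ω-Y : N (ω K.- Y) ≈ D
      ω-Y = trans (by-√3-and-½ (½ * ½ * (r * r)) ((ν 2 * ½ + 1#) * (r * r - √3 * r + 1#)) (solve 3 (λ h s r →
        (h :- h :* (s :* r :- κ 1)) :* (h :- h :* (s :* r :- κ 1)) :+ (h :* s :- h :* (s :- r)) :* (h :* s :- h :* (s :- r)) :=
        ((r :* r :- s :* r :+ κ 1) :+ (h :* h :* (r :* r)) :* (s :* s :- κ 3)) :+
        ((κ 2 :* h :+ κ 1) :* (r :* r :- s :* r :+ κ 1)) :* (κ 2 :* h :- κ 1)) refl ½ √3 r)) r²-√3r+1≈D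
      X-Y : N (X K.- Y) ≈ D
      X-Y = trans (by-√3-and-½ (½ * ½) ((ν 2 * ½ + 1#) * (r * r - √3 * r + 1#)) (solve 3 (λ h s r →
        (h :* (s :* r) :- h :* (s :* r :- κ 1)) :* (h :* (s :* r) :- h :* (s :* r :- κ 1)) :+ (h :* r :- h :* (s :- r)) :* (h :* r :- h :* (s :- r)) :=
        ((r :* r :- s :* r :+ κ 1) :+ (h :* h) :* (s :* s :- κ 3)) :+
        ((κ 2 :* h :+ κ 1) :* (r :* r :- s :* r :+ κ 1)) :* (κ 2 :* h :- κ 1)) refl ½ √3 r)) r²-√3r+1≈D

-- Comparison of the thresholds and the choice of r

module Thresholds (em : ExcludedMiddle 0ℓ) (ℝ : CompleteOrderedField) where
  open CompleteOrderedField ℝ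
  open Reals ℝ
  open OrderedField ℝ
  open UnitVectors em ℝ
  open PosetReasoning poset
  open RingSolver commutativeRing

  *-cancelˡ-≤ : ∀ n {x y} → ν (ℕ.suc n) * x ≤ ν (ℕ.suc n) * y → x ≤ y
  *-cancelˡ-≤ n {x} {y} p = *-cancelʳ-≤ em (ν-nonneg (ℕ.suc n)) (ν-nonzero n)
    (≤-trans (≤-reflexive (*-comm x _)) (≤-trans p (≤-reflexive (*-comm _ y))))

  -- Clears denominators: the nonnegative difference may be given for an integer multiple of both
  -- sides.
  scaled-≤ : ∀ n {x y z} → 0# ≤ z → z ≈ ν (ℕ.suc n) * y - ν (ℕ.suc n) * x → x ≤ y
  scaled-≤ n 0≤z eq = *-cancelˡ-≤ n (0≤z≈y-x⇒x≤y 0≤z eq)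

  square-mono : ∀ {x y} → 0# ≤ x → x ≤ y → x * x ≤ y * y
  square-mono {x} {y} 0≤x x≤y = ≤-trans (*-monoˡ-≤ 0≤x x≤y)
    (≤-trans (≤-reflexive (*-comm y x)) (*-monoˡ-≤ (≤-trans 0≤x x≤y) x≤y))

  √-≤ : ∀ {x y} → 0# ≤ x → √ x ≤ y → x ≤ y * y
  √-≤ {x} 0≤x √x≤y = ≤-trans (≤-reflexive (sym (√-square em 0≤x))) (square-mono (√-nonneg x) √x≤y)

  ≤-√ : ∀ {x y} → 0# ≤ x → 0# ≤ y → x ≤ √ y → x * x ≤ y
  ≤-√ 0≤x 0≤y x≤√y = ≤-trans (square-mono 0≤x x≤√y) (≤-reflexive (√-square em 0≤y))

  inverse : ∀ n → # (ℕ.suc n) * # (ℕ.suc n) ⁻¹ ≈ 1#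
  inverse n = ⁻¹-inverseʳ (#-nonzero n)

  a = √ # 2
  s = √3
  f = √ # 5
  h = # 2 ⁻¹
  k = # 15 ⁻¹
  i = f ⁻¹

  a² : a * a ≈ # 2
  a² = √-square em (#-nonneg 2)
  f² : f * f ≈ # 5
  f² = √-square em (#-nonneg 5)

  -- This and the next lemmas prove by squaring the rational bounds 7/5 ≤ √2 ≤ 3/2, 1 ≤ √3 ≤ 7/4 and
  -- 2 ≤ √5 ≤ 56/25, from which the thresholds are compared.
  7≤5a : 0# ≤ ν 5 * a - ν 7
  7≤5a = x≤y⇒0≤y-x (square-cancel-≤ em (*-nonneg (ν-nonneg 5) (√-nonneg _)) (0≤z≈y-x⇒x≤y 0≤1
    (sym (modulo (ν 25) a² (solve 1 (λ a → κ 5 :* a :* (κ 5 :* a) :- κ 7 :* κ 7 := κ 1 :+ κ 25 :* (a :* a :- :# 2)) refl a)))))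

  2a≤3 : 0# ≤ ν 3 - ν 2 * a
  2a≤3 = x≤y⇒0≤y-x (square-cancel-≤ em (ν-nonneg 3) (0≤z≈y-x⇒x≤y 0≤1
    (sym (modulo (- ν 4) a² (solve 1 (λ a → κ 3 :* κ 3 :- κ 2 :* a :* (κ 2 :* a) := κ 1 :+ (:- κ 4) :* (a :* a :- :# 2)) refl a)))))

  4s≤7 : 0# ≤ ν 7 - ν 4 * s
  4s≤7 = x≤y⇒0≤y-x (square-cancel-≤ em (ν-nonneg 7) (0≤z≈y-x⇒x≤y 0≤1
    (sym (modulo (- ν 16) √3²≈3 (solve 1 (λ s → κ 7 :* κ 7 :- κ 4 :* s :* (κ 4 :* s) := κ 1 :+ (:- κ 16) :* (s :* s :- κ 3)) refl s)))))

  1≤s : 0# ≤ s - 1#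
  1≤s = x≤y⇒0≤y-x (square-cancel-≤ em (√-nonneg _) (0≤z≈y-x⇒x≤y (ν-nonneg 2)
    (sym (modulo 1# √3²≈3 (solve 1 (λ s → s :* s :- κ 1 :* κ 1 := κ 2 :+ κ 1 :* (s :* s :- κ 3)) refl s)))))

  25f≤56 : 0# ≤ ν 56 - ν 25 * f
  25f≤56 = x≤y⇒0≤y-x (square-cancel-≤ em (ν-nonneg 56) (0≤z≈y-x⇒x≤y (ν-nonneg 11)
    (sym (modulo (- ν 625) f² (solve 1 (λ f → κ 56 :* κ 56 :- κ 25 :* f :* (κ 25 :* f) := κ 11 :+ (:- κ 625) :* (f :* f :- :# 5)) refl f)))))

  2≤f : 0# ≤ f - ν 2
  2≤f = x≤y⇒0≤y-x (square-cancel-≤ em (√-nonneg _) (0≤z≈y-x⇒x≤y 0≤1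
    (sym (modulo 1# f² (solve 1 (λ f → f :* f :- κ 2 :* κ 2 := κ 1 :+ κ 1 :* (f :* f :- :# 5)) refl f)))))

  2h≈1 : # 2 * h ≈ 1#
  2h≈1 = inverse 1
  15k≈1 : # 15 * k ≈ 1#
  15k≈1 = inverse 14

  f≉0 : ¬ f ≈ 0#
  f≉0 = 1≤yx⇒x≉0 {y = 1#} (0≤z≈y-x⇒x≤y (+-nonneg 2≤f 0≤1) (solve 1 (λ f → (f :- κ 2) :+ κ 1 := κ 1 :* f :- κ 1) refl f))

  fi≈1 : f * i ≈ 1#
  fi≈1 = ⁻¹-inverseʳ f≉0

  0≤i : 0# ≤ i
  0≤i = ⁻¹-nonneg em (√-nonneg _) f≉0

  25≤56i : 0# ≤ ν 56 * i - ν 25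
  25≤56i = ≤-trans (*-nonneg 25f≤56 0≤i) (≤-reflexive (modulo (- ν 25) fi≈1
    (solve 2 (λ f i → (κ 56 :- κ 25 :* f) :* i := (κ 56 :* i :- κ 25) :+ (:- κ 25) :* (f :* i :- κ 1)) refl f i)))

  2i≤1 : 0# ≤ 1# - ν 2 * i
  2i≤1 = ≤-trans (*-nonneg 2≤f 0≤i) (≤-reflexive (modulo 1# fi≈1
    (solve 2 (λ f i → (f :- κ 2) :* i := (κ 1 :- κ 2 :* i) :+ κ 1 :* (f :* i :- κ 1)) refl f i)))

  0≤3-s : 0# ≤ ν 3 - s
  0≤3-s = x≤y⇒0≤y-x (scaled-≤ 3 (+-nonneg 4s≤7 (ν-nonneg 5)) (solve 1 (λ s → (κ 7 :- κ 4 :* s) :+ κ 5 := κ 4 :* κ 3 :- κ 4 :* s) refl s))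

  -- The thresholds are α, √ β₁, √ γ₁, α √ δ₁, α √ δ₂, √ γ₂ and √ β₂.
  α β₁ β₂ γ₁ γ₂ δ₁ δ₂ : Carrier
  β₁ = # 1 / # 2 * (# 2 - √ # 2) * (# 3 - √ # 3)
  β₂ = # 1 / # 2 * (# 2 + √ # 2) * (# 3 - √ # 3)
  γ₁ = # 19 / # 15 - # 2 / √ # 5
  γ₂ = # 19 / # 15 + # 2 / √ # 5
  δ₁ = # 5 - # 2 * √ # 3
  δ₂ = # 5 + # 2 * √ # 3
  α  = # 1 / # 2

  -- Together with `4γ₁≤δ₁` and the lower bounds `1≤4β₁` and `1≤4γ₁`, this puts the first three
  -- intervals inside 1/2 ≤ d ≤ √δ₁/2.
  4β₁≤δ₁ : ν 4 * β₁ ≤ δ₁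
  4β₁≤δ₁ = scaled-≤ 4 (+-nonneg (*-nonneg (*-nonneg (ν-nonneg 2) 7≤5a) 0≤3-s) 4s≤7)
    (sym (modulo (- (ν 10 * (ν 2 - a) * (ν 3 - s))) 2h≈1 (solve 3 (λ a s h →
      κ 5 :* (:# 5 :- :# 2 :* s) :- κ 5 :* (κ 4 :* (:# 1 :* h :* (:# 2 :- a) :* (:# 3 :- s))) :=
      (κ 2 :* (κ 5 :* a :- κ 7) :* (κ 3 :- s) :+ (κ 7 :- κ 4 :* s)) :+
      (:- (κ 10 :* (κ 2 :- a) :* (κ 3 :- s))) :* (:# 2 :* h :- κ 1)) refl a s h)))

  -- Together with `δ₂≤4γ₂`, this puts the last three intervals inside d ≥ √δ₂/2.
  δ₂≤4β₂ : δ₂ ≤ ν 4 * β₂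
  δ₂≤4β₂ = scaled-≤ 4 (+-nonneg (*-nonneg (*-nonneg (ν-nonneg 2) 7≤5a) 0≤3-s) (*-nonneg (ν-nonneg 11) 4s≤7))
    (sym (modulo (ν 10 * (ν 2 + a) * (ν 3 - s)) 2h≈1 (solve 3 (λ a s h →
      κ 5 :* (κ 4 :* (:# 1 :* h :* (:# 2 :+ a) :* (:# 3 :- s))) :- κ 5 :* (:# 5 :+ :# 2 :* s) :=
      (κ 2 :* (κ 5 :* a :- κ 7) :* (κ 3 :- s) :+ κ 11 :* (κ 7 :- κ 4 :* s)) :+
      (κ 10 :* (κ 2 :+ a) :* (κ 3 :- s)) :* (:# 2 :* h :- κ 1)) refl a s h)))

  1≤4β₁ : 1# ≤ ν 4 * β₁
  1≤4β₁ = scaled-≤ 3 (+-nonneg (*-nonneg (*-nonneg (ν-nonneg 4) 2a≤3) 0≤3-s) (+-nonneg 4s≤7 0≤1))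
    (sym (modulo (ν 8 * (ν 2 - a) * (ν 3 - s)) 2h≈1 (solve 3 (λ a s h →
      κ 4 :* (κ 4 :* (:# 1 :* h :* (:# 2 :- a) :* (:# 3 :- s))) :- κ 4 :* κ 1 :=
      (κ 4 :* (κ 3 :- κ 2 :* a) :* (κ 3 :- s) :+ ((κ 7 :- κ 4 :* s) :+ κ 1)) :+
      (κ 8 :* (κ 2 :- a) :* (κ 3 :- s)) :* (:# 2 :* h :- κ 1)) refl a s h)))

  4γ₁≤δ₁ : ν 4 * γ₁ ≤ δ₁
  4γ₁≤δ₁ = scaled-≤ 209 (+-nonneg (*-nonneg (ν-nonneg 30) 25≤56i) (+-nonneg (*-nonneg (ν-nonneg 105) 4s≤7) 0≤1))
    (sym (modulo (- ν 1064) 15k≈1 (solve 3 (λ s k i →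
      κ 210 :* (:# 5 :- :# 2 :* s) :- κ 210 :* (κ 4 :* (:# 19 :* k :- :# 2 :* i)) :=
      (κ 30 :* (κ 56 :* i :- κ 25) :+ (κ 105 :* (κ 7 :- κ 4 :* s) :+ κ 1)) :+
      (:- κ 1064) :* (:# 15 :* k :- κ 1)) refl s k i)))

  δ₂≤4γ₂ : δ₂ ≤ ν 4 * γ₂
  δ₂≤4γ₂ = scaled-≤ 209 (+-nonneg (*-nonneg (ν-nonneg 30) 25≤56i) (+-nonneg (*-nonneg (ν-nonneg 105) 4s≤7) (ν-nonneg 29)))
    (sym (modulo (ν 1064) 15k≈1 (solve 3 (λ s k i →
      κ 210 :* (κ 4 :* (:# 19 :* k :+ :# 2 :* i)) :- κ 210 :* (:# 5 :+ :# 2 :* s) :=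
      (κ 30 :* (κ 56 :* i :- κ 25) :+ (κ 105 :* (κ 7 :- κ 4 :* s) :+ κ 29)) :+
      κ 1064 :* (:# 15 :* k :- κ 1)) refl s k i)))

  1≤4γ₁ : 1# ≤ ν 4 * γ₁
  1≤4γ₁ = scaled-≤ 14 (+-nonneg (*-nonneg (ν-nonneg 60) 2i≤1) 0≤1)
    (sym (modulo (ν 76) 15k≈1 (solve 2 (λ k i →
      κ 15 :* (κ 4 :* (:# 19 :* k :- :# 2 :* i)) :- κ 15 :* κ 1 :=
      (κ 60 :* (κ 1 :- κ 2 :* i) :+ κ 1) :+ κ 76 :* (:# 15 :* k :- κ 1)) refl k i)))

  4[½]²≈1 : ν 4 * (α * α) ≈ 1#
  4[½]²≈1 = modulo (# 2 * h + 1#) 2h≈1 (solve 1 (λ h →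
    κ 4 :* (:# 1 :* h :* (:# 1 :* h)) := κ 1 :+ (:# 2 :* h :+ κ 1) :* (:# 2 :* h :- κ 1)) refl h)

  0≤α : 0# ≤ α
  0≤α = *-nonneg (#-nonneg 1) (⁻¹-nonneg em (#-nonneg 2) (#-nonzero 1))

  4α²x≈x : ∀ x → 0# ≤ x → ν 4 * ((α * √ x) * (α * √ x)) ≈ x
  4α²x≈x x 0≤x = begin-equality
    ν 4 * ((α * √ x) * (α * √ x))    ≈⟨ solve 2 (λ α y → κ 4 :* ((α :* y) :* (α :* y)) := κ 4 :* (α :* α) :* (y :* y)) refl α (√ x) ⟩
    ν 4 * (α * α) * (√ x * √ x)      ≈⟨ *-cong 4[½]²≈1 (√-square em 0≤x) ⟩
    1# * x                           ≈⟨ *-identityˡ x ⟩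
    x                                ∎

  4*-mono-≤ : ∀ {x y} → x ≤ y → ν 4 * x ≤ ν 4 * y
  4*-mono-≤ {x} {y} x≤y = ≤-trans (≤-reflexive (*-comm (ν 4) x))
    (≤-trans (*-monoˡ-≤ (ν-nonneg 4) x≤y) (≤-reflexive (*-comm y (ν 4))))

  1≤δ₁ : 1# ≤ δ₁
  1≤δ₁ = ≤-trans 1≤4β₁ 4β₁≤δ₁

  1≤δ₂ : 1# ≤ δ₂
  1≤δ₂ = 0≤z≈y-x⇒x≤y (+-nonneg (ν-nonneg 6) (*-nonneg (ν-nonneg 2) 1≤s))
    (solve 1 (λ s → κ 6 :+ κ 2 :* (s :- κ 1) := (:# 5 :+ :# 2 :* s) :- κ 1) refl s)

  -- Since δ₁ - 1 = (√3 - 1)² and δ₂ - 1 = (√3 + 1)², the cases say that √(4D - 1) is at most √3 - 1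
  -- or at least √3 + 1. Either way the root (√3 - √(4D - 1))/2 has absolute value at least 1/2.
  data Admissible (D : Carrier) : Set where
    near : 1# ≤ ν 4 * D → ν 4 * D ≤ δ₁ → Admissible D
    far  : δ₂ ≤ ν 4 * D → Admissible D

  module _ {d} (0≤d : 0# ≤ d) where

    private
      below : ∀ {y} → 1# ≤ ν 4 * y → ν 4 * y ≤ δ₁ → d ≤ √ y → ν 4 * (d * d) ≤ δ₁
      below 1≤4y 4y≤δ₁ d≤√y = ≤-trans (4*-mono-≤ (≤-√ 0≤d (1≤4x⇒0≤x 1≤4y) d≤√y)) 4y≤δ₁

      above : ∀ {y} → 1# ≤ ν 4 * y → √ y ≤ d → 1# ≤ ν 4 * (d * d)
      above 1≤4y √y≤d = ≤-trans 1≤4y (4*-mono-≤ (√-≤ (1≤4x⇒0≤x 1≤4y) √y≤d))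

      beyond : ∀ {y} → δ₂ ≤ ν 4 * y → √ y ≤ d → δ₂ ≤ ν 4 * (d * d)
      beyond δ₂≤4y √y≤d = ≤-trans δ₂≤4y (4*-mono-≤ (√-≤ (1≤4x⇒0≤x (≤-trans 1≤δ₂ δ₂≤4y)) √y≤d))

    admissible₁ : α ≤ d → d ≤ √ β₁ → Admissible (d * d)
    admissible₁ α≤d d≤ = near
      (≤-trans (≤-reflexive (sym 4[½]²≈1)) (4*-mono-≤ (square-mono 0≤α α≤d)))
      (below 1≤4β₁ 4β₁≤δ₁ d≤)

    admissible₂ : √ β₁ < d → d ≤ √ γ₁ → Admissible (d * d)
    admissible₂ (≤d , _) d≤ = near (above 1≤4β₁ ≤d) (below 1≤4γ₁ 4γ₁≤δ₁ d≤)

    admissible₃ : √ γ₁ < d → d ≤ α * √ δ₁ → Admissible (d * d)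
    admissible₃ (≤d , _) d≤ = near (above 1≤4γ₁ ≤d)
      (≤-trans (4*-mono-≤ (square-mono 0≤d d≤)) (≤-reflexive (4α²x≈x δ₁ (≤-trans 0≤1 1≤δ₁))))

    admissible₄ : α * √ δ₂ ≤ d → Admissible (d * d)
    admissible₄ ≤d = far (≤-trans (≤-reflexive (sym (4α²x≈x δ₂ (≤-trans 0≤1 1≤δ₂))))
      (4*-mono-≤ (square-mono (*-nonneg 0≤α (√-nonneg δ₂)) ≤d)))

    admissible₅ : √ γ₂ ≤ d → Admissible (d * d)
    admissible₅ ≤d = far (beyond δ₂≤4γ₂ ≤d)

    admissible₆ : √ β₂ ≤ d → Admissible (d * d)
    admissible₆ ≤d = far (beyond δ₂≤4β₂ ≤d)

  admissible⇒1≤4D : ∀ {D} → Admissible D → 1# ≤ ν 4 * D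
  admissible⇒1≤4D (near 1≤4D _)  = 1≤4D
  admissible⇒1≤4D (far δ₂≤4D) = ≤-trans 1≤δ₂ δ₂≤4D

  -- r and √3 - r are the roots of x² - √3 x + 1 = D.
  module Roots {D} (adm : Admissible D) where
    E = ν 4 * D - 1#
    t = √ E
    r = ½ * (s - t)

    0≤E : 0# ≤ E
    0≤E = x≤y⇒0≤y-x (admissible⇒1≤4D adm)

    t² : t * t ≈ E
    t² = √-square em 0≤E

    r²-sr+1≈D : r * r - s * r + 1# ≈ D
    r²-sr+1≈D = modulo (½ * ½) t² (modulo (- (½ * ½)) √3²≈3 (modulo ((ν 2 * ½ + 1#) * (D - 1#) + s * (s - t)  * ½) 2½≈1
      (solve 4 (λ h s t d → h :* (s :- t) :* (h :* (s :- t)) :- s :* (h :* (s :- t)) :+ κ 1 :=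
        ((d :+ h :* h :* (t :* t :- (κ 4 :* d :- κ 1))) :+ (:- (h :* h)) :* (s :* s :- κ 3)) :+
        ((κ 2 :* h :+ κ 1) :* (d :- κ 1) :+ s :* (s :- t) :* h) :* (κ 2 :* h :- κ 1)) refl ½ s t D)))

    square-≥1 : ∀ {x y} → 1# ≤ y → y * y ≈ ν 4 * (x * x) → 1# ≤ ν 4 * (x * x)
    square-≥1 1≤y eq = ≤-trans (≤-reflexive (sym (*-identityˡ 1#))) (≤-trans (square-mono 0≤1 1≤y) (≤-reflexive eq))

    r-far : 1# ≤ ν 4 * (r * r)
    r-far = go adm
      where
      go : Admissible D → 1# ≤ ν 4 * (r * r)
      go (near _ 4D≤δ₁) = square-≥1 {y = s - t}
        (0≤z≈y-x⇒x≤y (x≤y⇒0≤y-x t≤s-1) (solve 2 (λ s t → (s :- κ 1) :- t := (s :- t) :- κ 1) refl s t))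
        (sym (modulo ((ν 2 * ½ + 1#) * ((s - t) * (s - t))) 2½≈1 (solve 3 (λ h s t →
          κ 4 :* (h :* (s :- t) :* (h :* (s :- t))) :=
          (s :- t) :* (s :- t) :+ ((κ 2 :* h :+ κ 1) :* ((s :- t) :* (s :- t))) :* (κ 2 :* h :- κ 1)) refl ½ s t)))
        where
        t≤s-1 : t ≤ s - 1#
        -- The difference of the squares is (4 - 2√3) - (4D - 1) = δ₁ - 4D.
        t≤s-1 = square-cancel-≤ em 1≤s (0≤z≈y-x⇒x≤y (x≤y⇒0≤y-x 4D≤δ₁)
          (sym (modulo (- 1#) t² (modulo 1# √3²≈3 (solve 3 (λ s t d →
            (s :- κ 1) :* (s :- κ 1) :- t :* t :=
            ((:# 5 :- :# 2 :* s) :- κ 4 :* d :+ (:- κ 1) :* (t :* t :- (κ 4 :* d :- κ 1))) :+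
            κ 1 :* (s :* s :- κ 3)) refl s t D)))))
      go (far δ₂≤4D) = square-≥1 {y = t - s}
        (0≤z≈y-x⇒x≤y (x≤y⇒0≤y-x s+1≤t) (solve 2 (λ s t → t :- (s :+ κ 1) := (t :- s) :- κ 1) refl s t))
        (sym (modulo ((ν 2 * ½ + 1#) * ((s - t) * (s - t))) 2½≈1 (solve 3 (λ h s t →
          κ 4 :* (h :* (s :- t) :* (h :* (s :- t))) :=
          (t :- s) :* (t :- s) :+ ((κ 2 :* h :+ κ 1) :* ((s :- t) :* (s :- t))) :* (κ 2 :* h :- κ 1)) refl ½ s t)))
        where
        s+1≤t : s + 1# ≤ t
        -- The difference of the squares is (4D - 1) - (4 + 2√3) = 4D - δ₂.
        s+1≤t = square-cancel-≤ em (√-nonneg E) (0≤z≈y-x⇒x≤y (x≤y⇒0≤y-x δ₂≤4D)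
          (sym (modulo 1# t² (modulo (- 1#) √3²≈3 (solve 3 (λ s t d →
            t :* t :- (s :+ κ 1) :* (s :+ κ 1) :=
            (κ 4 :* d :- (:# 5 :+ :# 2 :* s) :+ κ 1 :* (t :* t :- (κ 4 :* d :- κ 1))) :+
            (:- κ 1) :* (s :* s :- κ 3)) refl s t D)))))

    -- The other root is half of `s + t`, and `s + t` is at least 1 because √3 ≥ 1 and `t` is
    -- nonnegative.
    s-r-far : 1# ≤ ν 4 * ((s - r) * (s - r))
    s-r-far = square-≥1 {y = s + t}
      (0≤z≈y-x⇒x≤y (+-nonneg 1≤s (√-nonneg E)) (solve 2 (λ s t → (s :- κ 1) :+ t := (s :+ t) :- κ 1) refl s t))
      (sym (modulo (- (ν 2 * ((s + t) * (s - t))) + (ν 2 * ½ - 1#) * ((s - t) * (s - t))) 2½≈1 (solve 3 (λ h s t →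
        κ 4 :* ((s :- h :* (s :- t)) :* (s :- h :* (s :- t))) :=
        (s :+ t) :* (s :+ t) :+ (:- (κ 2 :* ((s :+ t) :* (s :- t))) :+ (κ 2 :* h :- κ 1) :* ((s :- t) :* (s :- t))) :* (κ 2 :* h :- κ 1)) refl ½ s t)))

-- The six bounds

module Conclusion
  (em : ExcludedMiddle 0ℓ) (ℝ : CompleteOrderedField)
  (c₀ : EuclideanPlane.Colouring ℝ) (proper : EuclideanPlane.Proper ℝ c₀) (𝝁 : EuclideanPlane.InvariantMeasure ℝ)
  where
  open EuclideanPlane ℝ
  open CompleteOrderedField ℝ
  open Reals ℝ
  open OrderedField ℝ
  open Complex commutativeRing using (N) renaming (module ℂ to K)
  open RandomColouring em ℝ c₀ proper 𝝁
  open Bounds em ℝ c₀ proper 𝝁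
  open Thresholds em ℝ
  open PosetReasoning poset
  open Mult semiring using (×1-homo-*)

  1≤140p : ∀ {D} → Admissible D → 1# ≤ ν 140 * prob D
  1≤140p adm = 140*prob≥1 r (admissible⇒1≤4D adm) r-far s-r-far r²-sr+1≈D
    where open Roots adm

  module _ {d A B} (dist≈d : dist A B ≈ d) where

    private
      p = InvariantMeasure.μ 𝝁 (monochromatic c₀ A B)

    0≤d : 0# ≤ d
    0≤d = ≤-trans (√-nonneg _) (≤-reflexive dist≈d)

    p≈prob : Admissible (d * d) → p ≈ prob (d * d)
    p≈prob adm = trans (sym (P-∼ A B)) (P-∼≈prob (admissible⇒1≤4D adm)
      (trans (sym (√-square em (+-nonneg (square-nonneg _) (square-nonneg _)))) (*-cong dist≈d dist≈d)))

    -- All six stated constants are at most 1/140, and `140 ℕ.* a ℕ.≤ ℕ.suc b` is that comparison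
    -- for a/(b + 1). The successor keeps the denominator nonzero.
    lower-bound : Admissible (d * d) → ∀ a b → 140 ℕ.* a ℕ.≤ ℕ.suc b → # a / # (ℕ.suc b) ≤ p
    lower-bound adm a b 140a≤b = *-cancelʳ-≤ em (#-nonneg (ℕ.suc b)) (#-nonzero b) (begin
      # a * # (ℕ.suc b) ⁻¹ * # (ℕ.suc b)    ≈⟨ trans (*-assoc _ _ _) (*-congˡ (trans (*-comm _ _) (inverse b))) ⟩
      # a * 1#                              ≈⟨ trans (*-identityʳ (# a)) (trans (#≈ν a) (sym (*-identityʳ (ν a)))) ⟩
      ν a * 1#                              ≈⟨ *-comm (ν a) 1# ⟩
      1# * ν a                              ≤⟨ *-monoˡ-≤ (ν-nonneg a) (1≤140p adm) ⟩
      ν 140 * prob (d * d) * ν a            ≈⟨ trans (*-assoc _ _ _) (trans (*-congˡ (*-comm _ _)) (sym (*-assoc _ _ _))) ⟩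
      ν 140 * ν a * prob (d * d)            ≈⟨ *-cong (sym (×1-homo-* 140 a)) (sym (p≈prob adm)) ⟩
      ν (140 ℕ.* a) * p                     ≤⟨ *-monoˡ-≤ (InvariantMeasure.μ-nonneg 𝝁 (monochromatic c₀ A B)) (ν-mono-≤ 140a≤b) ⟩
      ν (ℕ.suc b) * p                       ≈⟨ trans (*-comm _ p) (*-congˡ (sym (#≈ν (ℕ.suc b)))) ⟩
      p * # (ℕ.suc b)                       ∎)

    bounds-150 : Admissible (d * d) → # 1 / # 150 ≤ p
    bounds-150 adm = lower-bound adm 1 149 (ℕ.≤ᵇ⇒≤ 140 150 tt)

    bounds-2325 : Admissible (d * d) → # 14 / # 2325 ≤ p
    bounds-2325 adm = lower-bound adm 14 2324 (ℕ.≤ᵇ⇒≤ 1960 2325 tt)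

    bounds-300 : Admissible (d * d) → # 1 / # 300 ≤ p
    bounds-300 adm = lower-bound adm 1 299 (ℕ.≤ᵇ⇒≤ 140 300 tt)

mainTheorem6 :
  ExcludedMiddle 0ℓ →
  (ℝ : CompleteOrderedField) →
  let open CompleteOrderedField ℝ
      open Reals ℝ using (√_)
      open EuclideanPlane ℝ
  in
  (c₀ : Colouring) → Proper c₀ →
  (𝝁 : InvariantMeasure) →
  (d : Carrier) (A B : ℂ.Carrier) → dist A B ≈ d →
  let p = InvariantMeasure.μ 𝝁 (monochromatic c₀ A B) in
  (# 1 / # 2 ≤ d →
   d ≤ √ (# 1 / # 2 * (# 2 - √ # 2) * (# 3 - √ # 3)) →
   # 1 / # 150 ≤ p)
  ×
  (√ (# 1 / # 2 * (# 2 - √ # 2) * (# 3 - √ # 3)) < d →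
   d ≤ √ (# 19 / # 15 - # 2 / √ # 5) →
   # 14 / # 2325 ≤ p)
  ×
  (√ (# 19 / # 15 - # 2 / √ # 5) < d →
   d ≤ # 1 / # 2 * √ (# 5 - # 2 * √ # 3) →
   # 1 / # 300 ≤ p)
  ×
  (# 1 / # 2 * √ (# 5 + # 2 * √ # 3) ≤ d →
   d < √ (# 19 / # 15 + # 2 / √ # 5) →
   # 1 / # 300 ≤ p)
  ×
  (√ (# 19 / # 15 + # 2 / √ # 5) ≤ d →
   d < √ (# 1 / # 2 * (# 2 + √ # 2) * (# 3 - √ # 3)) →
   # 14 / # 2325 ≤ p)
  ×
  (√ (# 1 / # 2 * (# 2 + √ # 2) * (# 3 - √ # 3)) ≤ d →
   # 1 / # 150 ≤ p)
mainTheorem6 em ℝ c₀ proper 𝝁 d A B dist≈d =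
  (λ ≤d d≤ → bounds-150 dist≈d (admissible₁ (0≤d dist≈d) ≤d d≤)) ,
  (λ <d d≤ → bounds-2325 dist≈d (admissible₂ (0≤d dist≈d) <d d≤)) ,
  (λ <d d≤ → bounds-300 dist≈d (admissible₃ (0≤d dist≈d) <d d≤)) ,
  (λ ≤d _ → bounds-300 dist≈d (admissible₄ (0≤d dist≈d) ≤d)) ,
  (λ ≤d _ → bounds-2325 dist≈d (admissible₅ (0≤d dist≈d) ≤d)) ,
  (λ ≤d → bounds-150 dist≈d (admissible₆ (0≤d dist≈d) ≤d))
  where
  open Thresholds em ℝ
  open Conclusion em ℝ c₀ proper 𝝁
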